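{- Let $\lambda^{(1)},\dots,\lambda^{(b)}$ be partitions with total size $n$ and let $k$ be a positive integer dividing $n$. If $k$ divides $\gcd(|\lambda^{(1)}|,\dots,|\lambda^{(b)}|)$, then $$\mathrm{SYT}(\lambda^{(1)}\cup\dots\cup\lambda^{(b)})^{\mathrm{pr}^{n/k}}=\Big\{I_{n/k,M_1}(T_1)\cup\dots\cup I_{n/k,M_b}(T_b)\ :\ T_j\in\mathrm{SYT}(\lambda^{(j)})^{\mathrm{pr}^{|\lambda^{(j)}|/k}}\ \text{for all } j,\ (M_1,\dots,M_b)\ \text{an ordered set partition of } [n/k]\ \text{with } |M_j|=|\lambda^{(j)}|/k\Big\}.$$ Otherwise $\mathrm{SYT}(\lambda^{(1)}\cup\dots\cup\lambda^{(b)})^{\mathrm{pr}^{n/k}}=\varnothing$.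
   Context: English notation. $\lambda^{(1)}\cup\dots\cup\lambda^{(b)}$ is the skew shape obtained by placing the Young diagrams of $\lambda^{(1)},\dots,\lambda^{(b)}$ anti-diagonally, with $\lambda^{(1)}$ southwest of $\lambda^{(2)}$ southwest of $\lambda^{(3)}$, etc., no two pieces sharing a row or column; for fillings $S_j$ of $\lambda^{(j)}$, $S_1\cup\dots\cup S_b$ is the corresponding filling of this shape. $\mathrm{SYT}(\cdot)$ denotes standard fillings (entries $1,\dots,N$ once, rows increasing, columns increasing). Promotion $\mathrm{pr}$ on a standard filling with $N$ cells: delete $1$; repeatedly move into the empty cell the smaller of the entries immediately right of and immediately below it (in the shape) until it has neither; put $N+1$ there; subtract $1$ from all entries. $W^g$ denotes the fixed points of $g$ on $W$. For a standard tableau $T$ of size $N$, $m\ge1$ and $A=\{a_1<\dots<a_k\}\subseteq[m]$ with $k\mid N$, $I_{m,A}(T)$ is the filling obtained from $T$ by replacing each entry $ik+j$ ($0\le i\le N/k-1$, $1\le j\le k$) by $im+a_j$. -}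

module Defs where

open import Data.Nat using (ℕ; zero; suc; _+_; _*_; _∸_; _<_; _≥_; _≤ᵇ_; _<ᵇ_; _≡ᵇ_; NonZero)
open import Data.Nat.DivMod using (_/_; _%_)
open import Data.Nat.GCD using (gcd)
open import Data.Bool using (if_then_else_)
open import Data.Maybe using (Maybe; just; nothing)
open import Data.Product using (_×_; _,_; proj₁; proj₂)
open import Data.List using (List; []; _∷_; map; concat; reverse; length; foldr; upTo; zipWith)
open import Data.Nat.ListAction using (sum)
open import Data.List.Relation.Unary.All using (All)
open import Data.List.Relation.Unary.Linked using (Linked)
open import Data.List.Relation.Binary.Permutation.Propositional using (_↭_)
open import Relation.Binary.PropositionalEquality using (_≡_)

Partition : Set
Partition = List ℕ

IsPartition : Partition → Set
IsPartition λ′ = Linked _≥_ λ′ × All (0 <_) λ′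

∣_∣ₚ : Partition → ℕ
∣ λ′ ∣ₚ = sum λ′

gcdList : List ℕ → ℕ
gcdList = foldr gcd 0

-- Skew shapes: a list of rows, top to bottom; row i is (offset_i , length_i),
-- i.e. it consists of the cells (i , c) with offset_i ≤ c < offset_i + length_i.

SkewShape : Set
SkewShape = List (ℕ × ℕ)

straight : Partition → SkewShape
straight λ′ = map (λ r → (0 , r)) λ′

firstPart : Partition → ℕ
firstPart []      = 0
firstPart (r ∷ _) = r

placed : ℕ → List Partition → List SkewShape
placed c []          = []
placed c (λ′ ∷ ls)   = map (λ r → (c , r)) λ′ ∷ placed (c + firstPart λ′) ls

-- λ⁽¹⁾ ∪ ⋯ ∪ λ⁽ᵇ⁾ : λ⁽ᵇ⁾ topmost/rightmost, λ⁽¹⁾ bottom-left;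
-- no two pieces share a row or a column.
unionShape : List Partition → SkewShape
unionShape ls = concat (reverse (placed 0 ls))

-- Fillings: a list of rows (top to bottom), each a list of entries
-- (left to right), matching the rows of a skew shape.

Filling : Set
Filling = List (List ℕ)

unionFilling : List Filling → Filling
unionFilling Ss = concat (reverse Ss)

offsets : SkewShape → List ℕ
offsets = map proj₁

nthM : List ℕ → ℕ → Maybe ℕ
nthM []       _       = nothing
nthM (x ∷ _)  zero    = just x
nthM (_ ∷ xs) (suc j) = nthM xs j

setNth : List ℕ → ℕ → ℕ → List ℕ
setNth []       _       v = []
setNth (x ∷ xs) zero    v = v ∷ xs
setNth (x ∷ xs) (suc j) v = x ∷ setNth xs j v

get : List ℕ → Filling → ℕ → ℕ → Maybe ℕ
get (o ∷ os) (r ∷ F) zero    c = if o ≤ᵇ c then nthM r (c ∸ o) else nothing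
get (o ∷ os) (r ∷ F) (suc i) c = get os F i c
get _        _       _       _ = nothing

set : List ℕ → Filling → ℕ → ℕ → ℕ → Filling
set (o ∷ os) (r ∷ F) zero    c v = (if o ≤ᵇ c then setNth r (c ∸ o) v else r) ∷ F
set (o ∷ os) (r ∷ F) (suc i) c v = r ∷ set os F i c v
set _        F       _       _ v = F

findInRow : ℕ → List ℕ → Maybe ℕ
findInRow v []       = nothing
findInRow v (x ∷ xs) with x ≡ᵇ v | findInRow v xs
... | Data.Bool.true  | _       = just 0
... | Data.Bool.false | just j  = just (suc j)
... | Data.Bool.false | nothing = nothing

findCell : ℕ → List ℕ → Filling → Maybe (ℕ × ℕ)
findCell v (o ∷ os) (r ∷ F) with findInRow v r
... | just j  = just (0 , o + j)
... | nothing with findCell v os F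
...   | just (i , c) = just (suc i , c)
...   | nothing      = nothing
findCell v _ _ = nothing

cells : Filling → ℕ
cells F = sum (map length F)

-- jeu de taquin slide of the empty cell (i , c) (fuel bounds the number
-- of moves; the number of cells always suffices); finally put `top` there.
slide : ℕ → List ℕ → ℕ → Filling → ℕ → ℕ → Filling
slide zero    os top F i c = set os F i c top
slide (suc f) os top F i c with get os F i (suc c) | get os F (suc i) c
... | nothing | nothing = set os F i c top
... | just r  | nothing = slide f os top (set os F i c r) i (suc c)
... | nothing | just d  = slide f os top (set os F i c d) (suc i) c
... | just r  | just d  =
  if r <ᵇ d then slide f os top (set os F i c r) i (suc c)
            else slide f os top (set os F i c d) (suc i) c

pr : SkewShape → Filling → Filling
pr sh F with findCell 1 (offsets sh) F
... | nothing      = F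
... | just (i , c) =
  map (map (_∸ 1)) (slide (cells F) (offsets sh) (suc (cells F)) F i c)

iter : {A : Set} → ℕ → (A → A) → A → A
iter zero    f x = x
iter (suc m) f x = f (iter m f x)

IsSYT : SkewShape → Filling → Set
IsSYT sh F =
  (map length F ≡ map proj₂ sh)
  × (concat F ↭ map suc (upTo (sum (map proj₂ sh))))
  × All (Linked _<_) F
  × (∀ i c x y → get (offsets sh) F i c ≡ just x →
                 get (offsets sh) F (suc i) c ≡ just y → x < y)

FixedSYT : SkewShape → ℕ → Filling → Set
FixedSYT sh e T = IsSYT sh T × iter e (pr sh) T ≡ T

-- I_{m,A}(T), A = {a₁ < ⋯ < a_k} given as a strictly increasing list:
-- entry i·k + j (0 ≤ i, 1 ≤ j ≤ k) ↦ i·m + a_j.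

nth0 : List ℕ → ℕ → ℕ
nth0 []       _       = 0
nth0 (x ∷ _)  zero    = x
nth0 (_ ∷ xs) (suc j) = nth0 xs j

Ientry : ℕ → List ℕ → ℕ → ℕ
Ientry m A e with length A
... | zero   = e
... | suc k′ = ((e ∸ 1) / suc k′) * m + nth0 A ((e ∸ 1) % suc k′)

I : ℕ → List ℕ → Filling → Filling
I m A T = map (map (Ientry m A)) T

module Submission where

-- The entry 1 of a union lies in a single piece, and its slide stays there, so one promotion
-- step of the union promotes that piece and rotates the labels of all pieces cyclically by one.
-- Give each piece an increasing labelling β of its standardisation, with entries 0, …, N - 1,
-- extended by β (x + N) = β x + n.  After t steps the piece has been promoted once for each
-- label ≤ t.  If it returns after m = n / k steps, with c promotions made, comparing contents
-- gives β (x + c) = β x + m.  Iterating this k times gives β (x + k c) = β (x + N), whence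
-- k c = N, and β is determined by its values on 0, …, c - 1, which are the labels ≤ m.
-- Conversely, labels of this form return to themselves after m steps.

open import Defs
open import Data.Nat
open import Data.Nat.Properties
open import Data.Nat.DivMod
open import Data.Nat.Divisibility using (_∣_; divides; ∣-refl; ∣-trans; _∣0)
open import Data.Nat.GCD using (gcd-greatest; gcd[m,n]∣m; gcd[m,n]∣n)
open import Data.Nat.Induction using (<-rec)
open import Data.Nat.ListAction using (sum)
open import Data.Nat.ListAction.Properties using (sum-++)
open import Data.Bool using (true; false; T)
open import Data.Empty using (⊥-elim)
open import Data.Maybe using (Maybe; just; nothing; maybe′) renaming (map to mapM)
open import Data.Product using (_×_; ∃; ∃-syntax; _,_; proj₁; proj₂)
open import Data.Sum using (inj₁; inj₂)
open import Data.Unit using (tt)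
open import Data.List using (List; []; _∷_; [_]; _++_; map; concat; reverse; length; upTo; applyUpTo; zipWith; filter)
open import Data.List.Properties hiding (sum-++)
open import Data.List.Membership.Propositional using (_∈_; _∉_)
open import Data.List.Membership.Propositional.Properties using (∈-++⁺ˡ; ∈-++⁺ʳ; ∈-++⁻; ∈-applyUpTo⁻)
open import Data.List.Relation.Unary.All as All using (All; []; _∷_)
import Data.List.Relation.Unary.All.Properties as All
open import Data.List.Relation.Unary.Any using (here; there)
open import Data.List.Relation.Unary.Linked as Linked using (Linked; []; [-]; _∷_)
import Data.List.Relation.Unary.Linked.Properties as Linked
open import Data.List.Relation.Unary.Sorted.TotalOrder.Properties using (↗↭↗⇒≋)
open import Data.List.Relation.Unary.Unique.Propositional using (Unique; []; _∷_)
import Data.List.Relation.Unary.Unique.Propositional.Properties as Unique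
open import Data.List.Relation.Binary.Pointwise using (Pointwise; []; _∷_; Pointwise-≡⇒≡)
open import Data.List.Relation.Binary.Permutation.Propositional hiding (trans)
open import Data.List.Relation.Binary.Permutation.Propositional.Properties hiding (++-identityʳ; ++-assoc)
open import Data.List.Sort ≤-decTotalOrder using (sort; sort-↭; sort-↗)
open import Relation.Binary.Definitions using (tri<; tri≈; tri>)
open import Relation.Binary.PropositionalEquality hiding ([_])
open import Data.List.Relation.Binary.Permutation.Setoid.Properties (setoid ℕ) using (Unique-resp-↭)
open import Relation.Nullary using (¬_; yes; no; contradiction)
open import Function.Base using (_∘_; id; const)

-- Decrementing hides what a piece does. With `t` added back after `t` steps, the eviction of `β c`
-- inserts `β c + n`; the extension of `β` with period `(N, n)` makes this `β (c + N)`. Since a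
-- slide only compares entries, the piece is then `β` applied to `undecremented T c`, a filling that
-- does not depend on `β`. Hence, once `β (x + c) = β x + m` is known, the piece returns exactly
-- when `undecremented T c` is `T` with `c` added to every entry. This criterion no longer mentions
-- `β`; read with the labels 1, ..., N it says that `c` ordinary promotions fix the tableau. Both
-- directions of the theorem pass through it. That the label sets partition `[m]` is a matter of
-- content alone: they are the entries at most `m` of the pieces, and conversely their translates by
-- 0, m, ..., (k - 1) m tile `[n]`. The technical obstacle is that `pr` on a union runs with the
-- offsets, the fuel and the inserted label of the whole shape. Offsets and fuel are shown not to
-- influence a piece; the inserted label is kept as the parameter `n` of `step`.

mapF : (ℕ → ℕ) → Filling → Filling
mapF φ = map (map φ)

StrictMono : (ℕ → ℕ) → Set
StrictMono φ = ∀ {x y} → x < y → φ x < φ y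

T-ext : ∀ {a b} → (T a → T b) → (T b → T a) → a ≡ b
T-ext {false} {false} _ _ = refl
T-ext {false} {true}  _ g = ⊥-elim (g tt)
T-ext {true}  {false} f _ = ⊥-elim (f tt)
T-ext {true}  {true}  _ _ = refl

≤ᵇ-true : ∀ {m n} → m ≤ n → (m ≤ᵇ n) ≡ true
≤ᵇ-true m≤n = T-ext (λ _ → tt) (λ _ → ≤⇒≤ᵇ m≤n)

module _ {φ : ℕ → ℕ} (mono : StrictMono φ) where

  mono-reflects-< : ∀ {x y} → φ x < φ y → x < y
  mono-reflects-< {x} {y} lt with <-cmp x y
  ... | tri< x<y _ _ = x<y
  ... | tri≈ _ refl _ = ⊥-elim (<-irrefl refl lt)
  ... | tri> _ _ y<x = ⊥-elim (<-asym lt (mono y<x))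

  mono-injective : ∀ {x y} → φ x ≡ φ y → x ≡ y
  mono-injective {x} {y} eq with <-cmp x y
  ... | tri< x<y _ _ = ⊥-elim (<-irrefl eq (mono x<y))
  ... | tri≈ _ x≡y _ = x≡y
  ... | tri> _ _ y<x = ⊥-elim (<-irrefl (sym eq) (mono y<x))

  mono-≤ : ∀ {x y} → x ≤ y → φ x ≤ φ y
  mono-≤ x≤y with m≤n⇒m<n∨m≡n x≤y
  ... | inj₁ x<y  = <⇒≤ (mono x<y)
  ... | inj₂ refl = ≤-refl

  mapF-injective : ∀ {F G} → mapF φ F ≡ mapF φ G → F ≡ G
  mapF-injective = map-injective (map-injective mono-injective)

  <ᵇ-mono : ∀ x y → (φ x <ᵇ φ y) ≡ (x <ᵇ y)
  <ᵇ-mono x y = T-ext (λ t → <⇒<ᵇ (mono-reflects-< (<ᵇ⇒< _ _ t))) (λ t → <⇒<ᵇ (mono (<ᵇ⇒< _ _ t)))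

  ≡ᵇ-mono : ∀ x y → (φ x ≡ᵇ φ y) ≡ (x ≡ᵇ y)
  ≡ᵇ-mono x y = T-ext (λ t → ≡⇒≡ᵇ _ _ (mono-injective (≡ᵇ⇒≡ _ _ t))) (λ t → ≡⇒≡ᵇ _ _ (cong φ (≡ᵇ⇒≡ _ _ t)))

-- Slides under increasing relabelling

nthM-map : ∀ (φ : ℕ → ℕ) r j → nthM (map φ r) j ≡ mapM φ (nthM r j)
nthM-map φ []      j       = refl
nthM-map φ (x ∷ r) zero    = refl
nthM-map φ (x ∷ r) (suc j) = nthM-map φ r j

setNth-map : ∀ (φ : ℕ → ℕ) r j v → setNth (map φ r) j (φ v) ≡ map φ (setNth r j v)
setNth-map φ []      j       v = refl
setNth-map φ (x ∷ r) zero    v = refl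
setNth-map φ (x ∷ r) (suc j) v = cong (φ x ∷_) (setNth-map φ r j v)

get-map : ∀ φ os F i c → get os (mapF φ F) i c ≡ mapM φ (get os F i c)
get-map φ []       F       i       c = refl
get-map φ (o ∷ os) []      i       c = refl
get-map φ (o ∷ os) (r ∷ F) zero    c with o ≤ᵇ c
... | true  = nthM-map φ r (c ∸ o)
... | false = refl
get-map φ (o ∷ os) (r ∷ F) (suc i) c = get-map φ os F i c

set-map : ∀ φ os F i c v → set os (mapF φ F) i c (φ v) ≡ mapF φ (set os F i c v)
set-map φ []       F       i       c v = refl
set-map φ (o ∷ os) []      i       c v = refl
set-map φ (o ∷ os) (r ∷ F) zero    c v with o ≤ᵇ c
... | true  = cong (_∷ mapF φ F) (setNth-map φ r (c ∸ o) v)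
... | false = refl
set-map φ (o ∷ os) (r ∷ F) (suc i) c v = cong (map φ r ∷_) (set-map φ os F i c v)

-- The path of a slide is decided by comparisons of entries only, and a strictly increasing map
-- preserves them.
slide-map : ∀ {φ} → StrictMono φ → ∀ f os top F i c →
            slide f os (φ top) (mapF φ F) i c ≡ mapF φ (slide f os top F i c)
slide-map {φ} mono zero    os top F i c = set-map φ os F i c top
slide-map {φ} mono (suc f) os top F i c
  rewrite get-map φ os F i (suc c) | get-map φ os F (suc i) c
  with get os F i (suc c) | get os F (suc i) c
... | nothing | nothing = set-map φ os F i c top
... | just r  | nothing rewrite set-map φ os F i c r = slide-map mono f os top _ i (suc c)
... | nothing | just d  rewrite set-map φ os F i c d = slide-map mono f os top _ (suc i) c
... | just r  | just d
  rewrite <ᵇ-mono mono r d | set-map φ os F i c r | set-map φ os F i c d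
  with r <ᵇ d
...   | true  = slide-map mono f os top _ i (suc c)
...   | false = slide-map mono f os top _ (suc i) c

findInRow-map : ∀ {φ} → StrictMono φ → ∀ v r → findInRow (φ v) (map φ r) ≡ findInRow v r
findInRow-map mono v [] = refl
findInRow-map mono v (x ∷ r) rewrite ≡ᵇ-mono mono x v | findInRow-map mono v r
  with x ≡ᵇ v | findInRow v r
... | true  | _       = refl
... | false | just j  = refl
... | false | nothing = refl

findCell-map : ∀ {φ} → StrictMono φ → ∀ v os F → findCell (φ v) os (mapF φ F) ≡ findCell v os F
findCell-map mono v []       F  = refl
findCell-map mono v (o ∷ os) [] = refl
findCell-map mono v (o ∷ os) (r ∷ F) rewrite findInRow-map mono v r
  with findInRow v r
... | just j  = refl
... | nothing rewrite findCell-map mono v os F with findCell v os F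
...   | just (i , c) = refl
...   | nothing      = refl

slideFrom : ℕ → ℕ → List ℕ → Filling → Maybe (ℕ × ℕ) → Filling
slideFrom f top os F nothing        = F
slideFrom f top os F (just (i , c)) = slide f os top F i c

-- Promotion without the final decrement, for arbitrary evicted and inserted labels.
evict : ℕ → ℕ → ℕ → List ℕ → Filling → Filling
evict f v top os F = slideFrom f top os F (findCell v os F)

evict-map : ∀ {φ} → StrictMono φ → ∀ f v top os F →
            evict f (φ v) (φ top) os (mapF φ F) ≡ mapF φ (evict f v top os F)
evict-map mono f v top os F rewrite findCell-map mono v os F with findCell v os F
... | nothing      = refl
... | just (i , c) = slide-map mono f os top F i c

-- Contents and row lengths under a slide

nthM-∈ : ∀ r j {x} → nthM r j ≡ just x → x ∈ r
nthM-∈ (y ∷ r) zero    refl = here refl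
nthM-∈ (y ∷ r) (suc j) eq   = there (nthM-∈ r j eq)

get-∈ : ∀ os F i c {x} → get os F i c ≡ just x → x ∈ concat F
get-∈ (o ∷ os) (r ∷ F) zero c eq with o ≤ᵇ c
... | true = ∈-++⁺ˡ (nthM-∈ r (c ∸ o) eq)
get-∈ (o ∷ os) (r ∷ F) (suc i) c eq = ∈-++⁺ʳ r (get-∈ os F i c eq)

findInRow-nthM : ∀ v r {j} → findInRow v r ≡ just j → nthM r j ≡ just v
findInRow-nthM v (x ∷ r) eq with x ≡ᵇ v in e | findInRow v r in e′
findInRow-nthM v (x ∷ r) refl | true  | _      = cong just (≡ᵇ⇒≡ x v (subst T (sym e) tt))
findInRow-nthM v (x ∷ r) refl | false | just j = findInRow-nthM v r e′

findCell-get : ∀ v os F {i c} → findCell v os F ≡ just (i , c) → get os F i c ≡ just v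
findCell-get v (o ∷ os) (r ∷ F) eq with findInRow v r in e
findCell-get v (o ∷ os) (r ∷ F) refl | just j
  rewrite ≤ᵇ-true (m≤m+n o j) | m+n∸m≡n o j = findInRow-nthM v r e
findCell-get v (o ∷ os) (r ∷ F) eq   | nothing with findCell v os F in e′
findCell-get v (o ∷ os) (r ∷ F) refl | nothing | just (i , c) = findCell-get v os F e′

findInRow-∈ : ∀ v r → v ∈ r → ∃ λ j → findInRow v r ≡ just j
findInRow-∈ v (x ∷ r) p with x ≡ᵇ v in e | findInRow v r in e′
findInRow-∈ v (x ∷ r) p           | true  | _       = 0 , refl
findInRow-∈ v (x ∷ r) p           | false | just j  = suc j , refl
findInRow-∈ v (x ∷ r) (here refl) | false | nothing = ⊥-elim (subst T e (≡⇒≡ᵇ x x refl))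
findInRow-∈ v (x ∷ r) (there p)   | false | nothing with findInRow-∈ v r p
... | j , eq = contradiction (trans (sym e′) eq) λ ()

findCell-∈ : ∀ v os F → length os ≡ length F → v ∈ concat F → ∃ λ ic → findCell v os F ≡ just ic
findCell-∈ v (o ∷ os) (r ∷ F) len p with findInRow v r in e
... | just j = _ , refl
... | nothing with ∈-++⁻ r p
...   | inj₁ q with findInRow-∈ v r q
...     | j , eq = contradiction (trans (sym e) eq) λ ()
findCell-∈ v (o ∷ os) (r ∷ F) len p | nothing | inj₂ q
  with findCell-∈ v os F (suc-injective len) q
... | (i , c) , eq rewrite eq = _ , refl

findCell-∉ : ∀ v os F → v ∉ concat F → findCell v os F ≡ nothing
findCell-∉ v os F v∉ with findCell v os F in e
... | nothing      = refl
... | just (i , c) = ⊥-elim (v∉ (get-∈ os F i c (findCell-get v os F e)))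

evict-∉ : ∀ f v top os F → v ∉ concat F → evict f v top os F ≡ F
evict-∉ f v top os F v∉ rewrite findCell-∉ v os F v∉ = refl

setNth-↭ : ∀ r j {x} y → nthM r j ≡ just x → x ∷ setNth r j y ↭ y ∷ r
setNth-↭ (z ∷ r) zero    y refl = swap z y refl
setNth-↭ (z ∷ r) (suc j) {x} y eq =
  ↭-trans (swap x z refl) (↭-trans (prep z (setNth-↭ r j y eq)) (swap z y refl))

set-↭ : ∀ os F i c {x} y → get os F i c ≡ just x → x ∷ concat (set os F i c y) ↭ y ∷ concat F
set-↭ (o ∷ os) (r ∷ F) zero c y eq with o ≤ᵇ c
... | true = ++⁺ʳ (concat F) (setNth-↭ r (c ∸ o) y eq)
set-↭ (o ∷ os) (r ∷ F) (suc i) c {x} y eq = begin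
  x ∷ r ++ concat (set os F i c y)   ↭⟨ shift x r _ ⟨
  r ++ x ∷ concat (set os F i c y)   ↭⟨ ++⁺ˡ r (set-↭ os F i c y eq) ⟩
  r ++ y ∷ concat F                  ↭⟨ shift y r _ ⟩
  y ∷ r ++ concat F                  ∎
  where open PermutationReasoning

nthM-setNth-suc : ∀ r j v → nthM (setNth r j v) (suc j) ≡ nthM r (suc j)
nthM-setNth-suc []      j       v = refl
nthM-setNth-suc (x ∷ r) zero    v = refl
nthM-setNth-suc (x ∷ r) (suc j) v = nthM-setNth-suc r j v

-- The hole is never really empty: it keeps a stale value until overwritten. After a move the value
-- just copied is still present in the new hole, which is the stale value that the next move
-- replaces.
get-set-right : ∀ os F i c v → get os (set os F i c v) i (suc c) ≡ get os F i (suc c)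
get-set-right []       F       i       c v = refl
get-set-right (o ∷ os) []      i       c v = refl
get-set-right (o ∷ os) (r ∷ F) (suc i) c v = get-set-right os F i c v
get-set-right (o ∷ os) (r ∷ F) zero    c v with o ≤ᵇ c in e
... | false = refl
... | true with o≤c ← ≤ᵇ⇒≤ o c (subst T (sym e) tt)
  rewrite ≤ᵇ-true (m≤n⇒m≤1+n o≤c) | +-∸-assoc 1 o≤c = nthM-setNth-suc r (c ∸ o) v

get-set-down : ∀ os F i c v → get os (set os F i c v) (suc i) c ≡ get os F (suc i) c
get-set-down []       F       i       c v = refl
get-set-down (o ∷ os) []      i       c v = refl
get-set-down (o ∷ os) (r ∷ F) zero    c v with o ≤ᵇ c
... | true  = refl
... | false = refl
get-set-down (o ∷ os) (r ∷ F) (suc i) c v = get-set-down os F i c v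

-- Composes two replacements: if `x` was replaced by `y`, and afterwards the stale copy of `y` by
-- `z`, then in total `x` was replaced by `z`.
↭-exchange : ∀ {x y z : ℕ} {as bs cs} → x ∷ as ↭ y ∷ bs → y ∷ cs ↭ z ∷ as → x ∷ cs ↭ z ∷ bs
↭-exchange {x} {y} {z} {as} {bs} {cs} p q = drop-∷ (begin
  y ∷ x ∷ cs  ↭⟨ swap y x refl ⟩
  x ∷ y ∷ cs  ↭⟨ prep x q ⟩
  x ∷ z ∷ as  ↭⟨ swap x z refl ⟩
  z ∷ x ∷ as  ↭⟨ prep z p ⟩
  z ∷ y ∷ bs  ↭⟨ swap z y refl ⟩
  y ∷ z ∷ bs  ∎)
  where open PermutationReasoning

slide-↭ : ∀ f os top F i c {x} → get os F i c ≡ just x →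
          x ∷ concat (slide f os top F i c) ↭ top ∷ concat F
slide-↭ zero    os top F i c eq = set-↭ os F i c top eq
slide-↭ (suc f) os top F i c {x} eq
  with get os F i (suc c) in e₁ | get os F (suc i) c in e₂
... | nothing | nothing = set-↭ os F i c top eq
... | just r  | nothing = ↭-exchange (set-↭ os F i c r eq)
  (slide-↭ f os top _ i (suc c) (trans (get-set-right os F i c r) e₁))
... | nothing | just d  = ↭-exchange (set-↭ os F i c d eq)
  (slide-↭ f os top _ (suc i) c (trans (get-set-down os F i c d) e₂))
... | just r  | just d with r <ᵇ d
...   | true  = ↭-exchange (set-↭ os F i c r eq)
  (slide-↭ f os top _ i (suc c) (trans (get-set-right os F i c r) e₁))
...   | false = ↭-exchange (set-↭ os F i c d eq)
  (slide-↭ f os top _ (suc i) c (trans (get-set-down os F i c d) e₂))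

evict-↭ : ∀ f v top os F → length os ≡ length F → v ∈ concat F →
          v ∷ concat (evict f v top os F) ↭ top ∷ concat F
evict-↭ f v top os F len v∈ with findCell v os F in e
... | just (i , c) = slide-↭ f os top F i c (findCell-get v os F e)
... | nothing with findCell-∈ v os F len v∈
...   | _ , eq = contradiction (trans (sym e) eq) λ ()

length-setNth : ∀ r j v → length (setNth r j v) ≡ length r
length-setNth []      j       v = refl
length-setNth (x ∷ r) zero    v = refl
length-setNth (x ∷ r) (suc j) v = cong suc (length-setNth r j v)

set-lengths : ∀ os F i c v → map length (set os F i c v) ≡ map length F
set-lengths []       F       i       c v = refl
set-lengths (o ∷ os) []      i       c v = refl
set-lengths (o ∷ os) (r ∷ F) (suc i) c v = cong (length r ∷_) (set-lengths os F i c v)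
set-lengths (o ∷ os) (r ∷ F) zero    c v with o ≤ᵇ c
... | true  = cong (_∷ map length F) (length-setNth r (c ∸ o) v)
... | false = refl

slide-lengths : ∀ f os top F i c → map length (slide f os top F i c) ≡ map length F
slide-lengths zero    os top F i c = set-lengths os F i c top
slide-lengths (suc f) os top F i c with get os F i (suc c) | get os F (suc i) c
... | nothing | nothing = set-lengths os F i c top
... | just r  | nothing = trans (slide-lengths f os top _ i (suc c)) (set-lengths os F i c r)
... | nothing | just d  = trans (slide-lengths f os top _ (suc i) c) (set-lengths os F i c d)
... | just r  | just d with r <ᵇ d
...   | true  = trans (slide-lengths f os top _ i (suc c)) (set-lengths os F i c r)
...   | false = trans (slide-lengths f os top _ (suc i) c) (set-lengths os F i c d)

evict-lengths : ∀ f v top os F → map length (evict f v top os F) ≡ map length F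
evict-lengths f v top os F with findCell v os F
... | nothing      = refl
... | just (i , c) = slide-lengths f os top F i c

mapF-lengths : ∀ φ F → map length (mapF φ F) ≡ map length F
mapF-lengths φ F = trans (sym (map-∘ F)) (map-cong (length-map φ) F)

length-from-lengths : ∀ {F G : Filling} → map length F ≡ map length G → length F ≡ length G
length-from-lengths {F} {G} eq =
  trans (sym (length-map length F)) (trans (cong length eq) (length-map length G))

-- Locality of slides

get-lower : ∀ {os₁ os₂} V {S} i c → length os₁ ≡ length V →
            get (os₁ ++ os₂) (V ++ S) (length V + i) c ≡ get os₂ S i c
get-lower {[]}     []      i c eq = refl
get-lower {o ∷ os₁} (r ∷ V) i c eq = get-lower {os₁} V i c (suc-injective eq)

set-lower : ∀ {os₁ os₂} V {S} i c v → length os₁ ≡ length V →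
            set (os₁ ++ os₂) (V ++ S) (length V + i) c v ≡ V ++ set os₂ S i c v
set-lower {[]}      []      i c v eq = refl
set-lower {o ∷ os₁} (r ∷ V) i c v eq = cong (r ∷_) (set-lower V i c v (suc-injective eq))

-- A slide only moves right and down, so it never sees the rows above its start; no condition on
-- columns is involved.
slide-lower : ∀ f {os₁ os₂} top V S i c → length os₁ ≡ length V →
              slide f (os₁ ++ os₂) top (V ++ S) (length V + i) c ≡ V ++ slide f os₂ top S i c
slide-lower zero top V S i c len = set-lower V i c top len
slide-lower (suc f) {os₁} {os₂} top V S i c len
  rewrite sym (+-suc (length V) i)
        | get-lower {os₁} {os₂} V {S} i (suc c) len | get-lower {os₁} {os₂} V {S} (suc i) c len
  with get os₂ S i (suc c) | get os₂ S (suc i) c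
... | nothing | nothing = set-lower V i c top len
... | just r  | nothing rewrite set-lower {os₁} {os₂} V {S} i c r len =
  slide-lower f top V _ i (suc c) len
... | nothing | just d  rewrite set-lower {os₁} {os₂} V {S} i c d len | sym (+-suc (length V) i) =
  slide-lower f top V _ (suc i) c len
... | just r  | just d
  rewrite set-lower {os₁} {os₂} V {S} i c r len | set-lower {os₁} {os₂} V {S} i c d len
  with r <ᵇ d
...   | true  = slide-lower f top V _ i (suc c) len
...   | false rewrite sym (+-suc (length V) i) = slide-lower f top V _ (suc i) c len

-- Constraining row 0 is enough: a slide can leave the block above only through the row directly
-- under it, and its column never decreases, so a bound `o ≤ c` valid at its start remains valid.
NothingBelow : ℕ → List ℕ → Filling → Set
NothingBelow o os S = ∀ c → o ≤ c → get os S 0 c ≡ nothing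

get-just-< : ∀ os F i c {x} → get os F i c ≡ just x → i < length F
get-just-< (o ∷ os) (r ∷ F) zero    c eq = s≤s z≤n
get-just-< (o ∷ os) (r ∷ F) (suc i) c eq = s≤s (get-just-< os F i c eq)

-- The case that matters is `i = length V`: the left side reads the first row of `S` at a column
-- where it has no cell, and `V` has no such row, so both are `nothing`.
get-upper : ∀ {o os₁ os₂} V {S} i c → length os₁ ≡ length V → NothingBelow o os₂ S → o ≤ c →
            i ≤ length V → get (os₁ ++ os₂) (V ++ S) i c ≡ get os₁ V i c
get-upper {os₁ = []}      []      zero    c len nb o≤c i≤ = nb c o≤c
get-upper {os₁ = o ∷ os₁} (r ∷ V) zero    c len nb o≤c i≤ = refl
get-upper {os₁ = o ∷ os₁} (r ∷ V) (suc i) c len nb o≤c (s≤s i≤) =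
  get-upper {os₁ = os₁} V i c (suc-injective len) nb o≤c i≤

set-upper : ∀ {os₁ os₂} V {S} i c v → length os₁ ≡ length V → i < length V →
            set (os₁ ++ os₂) (V ++ S) i c v ≡ set os₁ V i c v ++ S
set-upper {o ∷ os₁} (r ∷ V) zero    c v len i<        = refl
set-upper {o ∷ os₁} (r ∷ V) (suc i) c v len (s≤s i<) =
  cong (r ∷_) (set-upper V i c v (suc-injective len) i<)

-- A downward move needs an entry below the hole, and `get-upper` locates that entry in `V` itself,
-- so the hole cannot cross into `S`.
slide-upper : ∀ f {o os₁ os₂} top V S i c → length os₁ ≡ length V → NothingBelow o os₂ S →
              o ≤ c → i < length V →
              slide f (os₁ ++ os₂) top (V ++ S) i c ≡ slide f os₁ top V i c ++ S
slide-upper zero top V S i c len nb o≤c i< = set-upper V i c top len i<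
slide-upper (suc f) {o} {os₁} {os₂} top V S i c len nb o≤c i< = move
  where
  length-set : ∀ v → length V ≡ length (set os₁ V i c v)
  length-set v = length-from-lengths {V} (sym (set-lengths os₁ V i c v))
  goRight : ∀ r → slide f (os₁ ++ os₂) top (set (os₁ ++ os₂) (V ++ S) i c r) i (suc c)
                ≡ slide f os₁ top (set os₁ V i c r) i (suc c) ++ S
  goRight r rewrite set-upper {os₁} {os₂} V {S} i c r len i< =
    slide-upper f top _ S i (suc c) (trans len (length-set r)) nb (m≤n⇒m≤1+n o≤c)
      (subst (i <_) (length-set r) i<)
  goDown : ∀ d → get os₁ V (suc i) c ≡ just d →
           slide f (os₁ ++ os₂) top (set (os₁ ++ os₂) (V ++ S) i c d) (suc i) c
         ≡ slide f os₁ top (set os₁ V i c d) (suc i) c ++ S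
  goDown d e rewrite set-upper {os₁} {os₂} V {S} i c d len i< =
    slide-upper f top _ S (suc i) c (trans len (length-set d)) nb o≤c
      (subst (suc i <_) (length-set d) (get-just-< os₁ V (suc i) c e))
  move : slide (suc f) (os₁ ++ os₂) top (V ++ S) i c ≡ slide (suc f) os₁ top V i c ++ S
  move
    rewrite get-upper {o} {os₁} {os₂} V {S} i (suc c) len nb (m≤n⇒m≤1+n o≤c) (<⇒≤ i<)
          | get-upper {o} {os₁} {os₂} V {S} (suc i) c len nb o≤c i<
    with get os₁ V i (suc c) | get os₁ V (suc i) c in e
  ... | nothing | nothing = set-upper V i c top len i<
  ... | just r  | nothing = goRight r
  ... | nothing | just d  = goDown d e
  ... | just r  | just d with r <ᵇ d
  ...   | true  = goRight r
  ...   | false = goDown d e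

-- Translation of columns and sufficiency of fuel

≤ᵇ-shift : ∀ s m n → (s + m ≤ᵇ s + n) ≡ (m ≤ᵇ n)
≤ᵇ-shift s m n = T-ext (λ t → ≤⇒≤ᵇ (+-cancelˡ-≤ s m n (≤ᵇ⇒≤ _ _ t)))
                       (λ t → ≤⇒≤ᵇ (+-monoʳ-≤ s (≤ᵇ⇒≤ m n t)))

get-shift : ∀ s os F i c → get (map (s +_) os) F i (s + c) ≡ get os F i c
get-shift s []       F       i       c = refl
get-shift s (o ∷ os) []      i       c = refl
get-shift s (o ∷ os) (r ∷ F) (suc i) c = get-shift s os F i c
get-shift s (o ∷ os) (r ∷ F) zero    c
  rewrite ≤ᵇ-shift s o c | [m+n]∸[m+o]≡n∸o s c o = refl

set-shift : ∀ s os F i c v → set (map (s +_) os) F i (s + c) v ≡ set os F i c v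
set-shift s []       F       i       c v = refl
set-shift s (o ∷ os) []      i       c v = refl
set-shift s (o ∷ os) (r ∷ F) (suc i) c v = cong (r ∷_) (set-shift s os F i c v)
set-shift s (o ∷ os) (r ∷ F) zero    c v
  rewrite ≤ᵇ-shift s o c | [m+n]∸[m+o]≡n∸o s c o = refl

slide-shift : ∀ f s os top F i c → slide f (map (s +_) os) top F i (s + c) ≡ slide f os top F i c
slide-shift zero    s os top F i c = set-shift s os F i c top
slide-shift (suc f) s os top F i c
  rewrite sym (+-suc s c) | get-shift s os F i (suc c) | get-shift s os F (suc i) c
  with get os F i (suc c) | get os F (suc i) c
... | nothing | nothing = set-shift s os F i c top
... | just r  | nothing rewrite set-shift s os F i c r | sym (+-suc s c) =
  slide-shift f s os top _ i (suc c)
... | nothing | just d  rewrite set-shift s os F i c d = slide-shift f s os top _ (suc i) c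
... | just r  | just d  rewrite set-shift s os F i c r | set-shift s os F i c d
  with r <ᵇ d
...   | true  rewrite sym (+-suc s c) = slide-shift f s os top _ i (suc c)
...   | false = slide-shift f s os top _ (suc i) c

shiftColumn : ℕ → ℕ × ℕ → ℕ × ℕ
shiftColumn s (i , c) = i , s + c

findCell-shift : ∀ s v os F → findCell v (map (s +_) os) F ≡ mapM (shiftColumn s) (findCell v os F)
findCell-shift s v []       F  = refl
findCell-shift s v (o ∷ os) [] = refl
findCell-shift s v (o ∷ os) (r ∷ F) with findInRow v r
... | just j  rewrite +-assoc s o j = refl
... | nothing rewrite findCell-shift s v os F with findCell v os F
...   | just (i , c) = refl
...   | nothing      = refl

evict-shift : ∀ f s v top os F → evict f v top (map (s +_) os) F ≡ evict f v top os F
evict-shift f s v top os F rewrite findCell-shift s v os F with findCell v os F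
... | nothing      = refl
... | just (i , c) = slide-shift f s os top F i c

-- cellsFrom F i (suc c) bounds the number of moves of a slide from (i , c).
cellsFrom : Filling → ℕ → ℕ → ℕ
cellsFrom []      i       c = 0
cellsFrom (r ∷ F) zero    c = (length r ∸ c) + cells F
cellsFrom (r ∷ F) (suc i) c = cellsFrom F i c

cells-cong : ∀ {F G} → map length F ≡ map length G → cells F ≡ cells G
cells-cong eq = cong sum eq

cellsFrom-cong : ∀ F G i c → map length F ≡ map length G → cellsFrom F i c ≡ cellsFrom G i c
cellsFrom-cong []      []      i       c eq = refl
cellsFrom-cong (r ∷ F) (q ∷ G) zero    c eq =
  cong₂ (λ l m → (l ∸ c) + m) (∷-injectiveˡ eq) (cells-cong {F} {G} (∷-injectiveʳ eq))
cellsFrom-cong (r ∷ F) (q ∷ G) (suc i) c eq = cellsFrom-cong F G i c (∷-injectiveʳ eq)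

cellsFrom≤cells : ∀ F i c → cellsFrom F i c ≤ cells F
cellsFrom≤cells []      i       c = z≤n
cellsFrom≤cells (r ∷ F) zero    c = +-monoˡ-≤ (cells F) (m∸n≤m (length r) c)
cellsFrom≤cells (r ∷ F) (suc i) c = ≤-trans (cellsFrom≤cells F i c) (m≤n+m (cells F) (length r))

nthM-just-< : ∀ r j {x} → nthM r j ≡ just x → j < length r
nthM-just-< (x ∷ r) zero    eq = s≤s z≤n
nthM-just-< (x ∷ r) (suc j) eq = s≤s (nthM-just-< r j eq)

-- Zero offsets are assumed because `cellsFrom` counts positions within a row, which agree with
-- columns only then.
cellsFrom-right : ∀ {os} F i c {x} → All (_≡ 0) os → get os F i c ≡ just x →
                  cellsFrom F i (suc c) < cellsFrom F i c
cellsFrom-right (r ∷ F) zero    c (refl ∷ _) eq =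
  +-monoˡ-< (cells F) (∸-monoʳ-< (n<1+n c) (nthM-just-< r c eq))
cellsFrom-right (r ∷ F) (suc i) c (_ ∷ zs) eq = cellsFrom-right F i c zs eq

cellsFrom-down : ∀ {os} F i c {x} → All (_≡ 0) os → get os F (suc i) c ≡ just x →
                 cellsFrom F (suc i) (suc c) < cellsFrom F i (suc c)
cellsFrom-down (r ∷ q ∷ F) zero c (_ ∷ refl ∷ _) eq = begin-strict
  (length q ∸ suc c) + cells F             <⟨ +-monoˡ-< (cells F) (∸-monoʳ-< z<s (nthM-just-< q c eq)) ⟩
  length q + cells F                       ≤⟨ m≤n+m _ (length r ∸ suc c) ⟩
  (length r ∸ suc c) + (length q + cells F) ∎
  where open ≤-Reasoning
cellsFrom-down {o ∷ []} (r ∷ []) zero c (_ ∷ _) ()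
cellsFrom-down {o ∷ _ ∷ _} (r ∷ []) zero c (_ ∷ _) ()
cellsFrom-down (r ∷ F) (suc i) c (_ ∷ zs) eq = cellsFrom-down F i c zs eq

-- At fuel 0 the bound leaves no cell to the right or below, so the extra unit can only place `top`.
-- Otherwise every move lowers `cellsFrom F i (suc c)`, and the bound survives with one unit less.
slide-suc : ∀ f {os} top F i c → All (_≡ 0) os → cellsFrom F i (suc c) ≤ f →
            slide (suc f) os top F i c ≡ slide f os top F i c
slide-suc zero {os} top F i c zs le with get os F i (suc c) in e₁ | get os F (suc i) c in e₂
... | nothing | nothing = refl
... | just r  | _       = contradiction (<-≤-trans (cellsFrom-right F i (suc c) zs e₁) le) λ ()
... | nothing | just d  = contradiction (<-≤-trans (cellsFrom-down F i c zs e₂) le) λ ()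
slide-suc (suc f) {os} top F i c zs le = move
  where
  bound : ∀ v i′ c′ → cellsFrom F i′ (suc c′) < cellsFrom F i (suc c) →
          cellsFrom (set os F i c v) i′ (suc c′) ≤ f
  bound v i′ c′ lt rewrite cellsFrom-cong (set os F i c v) F i′ (suc c′) (set-lengths os F i c v) =
    ≤-pred (<-≤-trans lt le)
  move : slide (suc (suc f)) os top F i c ≡ slide (suc f) os top F i c
  move with get os F i (suc c) in e₁ | get os F (suc i) c in e₂
  ... | nothing | nothing = refl
  ... | just r  | nothing = slide-suc f top _ i (suc c) zs (bound r i (suc c) (cellsFrom-right F i (suc c) zs e₁))
  ... | nothing | just d  = slide-suc f top _ (suc i) c zs (bound d (suc i) c (cellsFrom-down F i c zs e₂))
  ... | just r  | just d with r <ᵇ d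
  ...   | true  = slide-suc f top _ i (suc c) zs (bound r i (suc c) (cellsFrom-right F i (suc c) zs e₁))
  ...   | false = slide-suc f top _ (suc i) c zs (bound d (suc i) c (cellsFrom-down F i c zs e₂))

slide-fuel : ∀ f d {os} top F i c → All (_≡ 0) os → cells F ≤ f →
             slide (d + f) os top F i c ≡ slide f os top F i c
slide-fuel f zero    top F i c zs le = refl
slide-fuel f (suc d) top F i c zs le = trans
  (slide-suc (d + f) top F i c zs (≤-trans (cellsFrom≤cells F i (suc c)) (≤-trans le (m≤n+m f d))))
  (slide-fuel f d top F i c zs le)

evict-fuel : ∀ {f os} v top F → All (_≡ 0) os → cells F ≤ f →
             evict f v top os F ≡ evict (cells F) v top os F
evict-fuel {f} {os} v top F zs le with findCell v os F
... | nothing      = refl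
... | just (i , c) = trans (cong (λ g → slide g os top F i c) (sym (m∸n+n≡m le)))
                           (slide-fuel (cells F) (f ∸ cells F) top F i c zs ≤-refl)

findCell-++ : ∀ v os₁ {os₂} V {S} → length os₁ ≡ length V →
  findCell v (os₁ ++ os₂) (V ++ S) ≡
  maybe′ just (mapM (λ (i , c) → length V + i , c) (findCell v os₂ S)) (findCell v os₁ V)
findCell-++ v []        {os₂} []  {S} len with findCell v os₂ S
... | nothing = refl
... | just _  = refl
findCell-++ v (o ∷ os₁) {os₂} (r ∷ V) {S} len with findInRow v r
... | just j  = refl
... | nothing rewrite findCell-++ v os₁ {os₂} V {S} (suc-injective len) with findCell v os₁ V
...   | just _  = refl
...   | nothing with findCell v os₂ S
...     | just _  = refl
...     | nothing = refl

get-offset-≤ : ∀ {o} os F i c {x} → All (o ≤_) os → get os F i c ≡ just x → o ≤ c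
get-offset-≤ (p ∷ os) (r ∷ F) zero c (o≤p ∷ _) eq with p ≤ᵇ c in e
... | true = ≤-trans o≤p (≤ᵇ⇒≤ p c (subst T (sym e) tt))
get-offset-≤ (p ∷ os) (r ∷ F) (suc i) c (_ ∷ os≥) eq = get-offset-≤ os F i c os≥ eq

-- Evicting an absent label changes nothing, so the append on the right is correct wherever `v`
-- lies. Disjointness is needed because `findCell` stops at its first hit, whereas on the right both
-- blocks would react.
evict-++ : ∀ f v top {o} os₁ os₂ V S → length os₁ ≡ length V → All (o ≤_) os₁ →
           NothingBelow o os₂ S → (v ∈ concat V → v ∉ concat S) →
           evict f v top (os₁ ++ os₂) (V ++ S) ≡ evict f v top os₁ V ++ evict f v top os₂ S
evict-++ f v top os₁ os₂ V S len os≥ nb disj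
  rewrite findCell-++ v os₁ {os₂} V {S} len
  with findCell v os₁ V in e
... | just (i , c) with e′ ← findCell-get v os₁ V e
  rewrite findCell-∉ v os₂ S (disj (get-∈ os₁ V i c e′)) =
  slide-upper f top V S i c len nb (get-offset-≤ os₁ V i c os≥ e′) (get-just-< os₁ V i c e′)
... | nothing with findCell v os₂ S
...   | nothing      = refl
...   | just (i , c) = slide-lower f top V S i c len

-- Promotion of a union

zeros : Filling → List ℕ
zeros = map (const 0)

zeros-0 : ∀ F → All (_≡ 0) (zeros F)
zeros-0 []      = []
zeros-0 (r ∷ F) = refl ∷ zeros-0 F

-- A normal form: the piece sits at column 0 and its own size is the fuel, so nothing depends on its
-- place in the union or on the other pieces.
evict₀ : ℕ → ℕ → Filling → Filling
evict₀ v top F = evict (cells F) v top (zeros F) F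

-- Here `n` is the size of the union, not of `F`: the inserted label is the same for all pieces. A
-- piece without the entry 1 is merely decremented.
step : ℕ → Filling → Filling
step n F = mapF (_∸ 1) (evict₀ 1 (suc n) F)

zeros-cong : ∀ F G → map length F ≡ map length G → zeros F ≡ zeros G
zeros-cong F G eq = trans (map-∘ F) (trans (cong (map (const 0)) eq) (sym (map-∘ G)))

evict₀-map : ∀ {φ} → StrictMono φ → ∀ v top F →
             evict₀ (φ v) (φ top) (mapF φ F) ≡ mapF φ (evict₀ v top F)
evict₀-map {φ} mono v top F
  rewrite cells-cong {mapF φ F} {F} (mapF-lengths φ F) | zeros-cong (mapF φ F) F (mapF-lengths φ F) =
  evict-map mono (cells F) v top (zeros F) F

evict₀-↭ : ∀ v top F → v ∈ concat F → v ∷ concat (evict₀ v top F) ↭ top ∷ concat F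
evict₀-↭ v top F = evict-↭ (cells F) v top (zeros F) F (length-map _ F)

step-lengths : ∀ n F → map length (step n F) ≡ map length F
step-lengths n F = trans (mapF-lengths _ (evict₀ 1 (suc n) F)) (evict-lengths (cells F) 1 (suc n) (zeros F) F)

concat-reverse-∷ : ∀ {A : Set} (xs : List A) xss → concat (reverse (xs ∷ xss)) ≡ concat (reverse xss) ++ xs
concat-reverse-∷ xs xss = begin
  concat (reverse (xs ∷ xss))             ≡⟨ cong concat (unfold-reverse xs xss) ⟩
  concat (reverse xss ++ [ xs ])          ≡⟨ concat-++ (reverse xss) [ xs ] ⟨
  concat (reverse xss) ++ (xs ++ [])      ≡⟨ cong (concat (reverse xss) ++_) (++-identityʳ xs) ⟩
  concat (reverse xss) ++ xs              ∎
  where open ≡-Reasoning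

HasShape : Partition → Filling → Set
HasShape λ′ F = map length F ≡ λ′

placedOffsets : ℕ → List Partition → List ℕ
placedOffsets s ls = offsets (concat (reverse (placed s ls)))

row-offsets : ∀ s λ′ F → HasShape λ′ F → offsets (map (λ r → s , r) λ′) ≡ map (s +_) (zeros F)
row-offsets s .(map length F) F refl = begin
  map proj₁ (map (λ r → s , r) (map length F)) ≡⟨ map-∘ (map length F) ⟨
  map (const s) (map length F)                 ≡⟨ map-∘ F ⟨
  map (const s) F                              ≡⟨ map-cong (λ _ → sym (+-identityʳ s)) F ⟩
  map (λ _ → s + 0) F                          ≡⟨ map-∘ F ⟩
  map (s +_) (zeros F)                         ∎
  where open ≡-Reasoning

placedOffsets-∷ : ∀ s λ′ ls F → HasShape λ′ F →
  placedOffsets s (λ′ ∷ ls) ≡ placedOffsets (s + firstPart λ′) ls ++ map (s +_) (zeros F)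
placedOffsets-∷ s λ′ ls F sh = begin
  offsets (concat (reverse (placed s (λ′ ∷ ls))))
    ≡⟨ cong offsets (concat-reverse-∷ (map (λ r → s , r) λ′) (placed (s + firstPart λ′) ls)) ⟩
  offsets (concat (reverse (placed (s + firstPart λ′) ls)) ++ map (λ r → s , r) λ′)
    ≡⟨ map-++ proj₁ (concat (reverse (placed (s + firstPart λ′) ls))) _ ⟩
  placedOffsets (s + firstPart λ′) ls ++ offsets (map (λ r → s , r) λ′)
    ≡⟨ cong (placedOffsets (s + firstPart λ′) ls ++_) (row-offsets s λ′ F sh) ⟩
  placedOffsets (s + firstPart λ′) ls ++ map (s +_) (zeros F) ∎
  where open ≡-Reasoning

placedOffsets-length : ∀ s ls Fs → Pointwise HasShape ls Fs →
                       length (placedOffsets s ls) ≡ length (unionFilling Fs)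
placedOffsets-length s [] [] [] = refl
placedOffsets-length s (λ′ ∷ ls) (F ∷ Fs) (sh ∷ shs) = begin
  length (placedOffsets s (λ′ ∷ ls))
    ≡⟨ cong length (placedOffsets-∷ s λ′ ls F sh) ⟩
  length (placedOffsets (s + firstPart λ′) ls ++ map (s +_) (zeros F))
    ≡⟨ length-++ (placedOffsets (s + firstPart λ′) ls) ⟩
  length (placedOffsets (s + firstPart λ′) ls) + length (map (s +_) (zeros F))
    ≡⟨ cong₂ _+_ (placedOffsets-length (s + firstPart λ′) ls Fs shs) (trans (length-map _ (zeros F)) (length-map _ F)) ⟩
  length (unionFilling Fs) + length F
    ≡⟨ length-++ (unionFilling Fs) ⟨
  length (unionFilling Fs ++ F)
    ≡⟨ cong length (concat-reverse-∷ F Fs) ⟨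
  length (unionFilling (F ∷ Fs)) ∎
  where open ≡-Reasoning

placed-≥ : ∀ s ls → All (All ((s ≤_) ∘ proj₁)) (placed s ls)
placed-≥ s []        = []
placed-≥ s (λ′ ∷ ls) = All.map⁺ (All.universal (λ _ → ≤-refl) λ′) ∷
  All.map (All.map (≤-trans (m≤m+n s (firstPart λ′)))) (placed-≥ (s + firstPart λ′) ls)

placedOffsets-≥ : ∀ s ls → All (s ≤_) (placedOffsets s ls)
placedOffsets-≥ s ls = All.map⁺ (All.concat⁺ (All-resp-↭ (↭-sym (↭-reverse (placed s ls))) (placed-≥ s ls)))

nthM-≥ : ∀ (r : List ℕ) j → length r ≤ j → nthM r j ≡ nothing
nthM-≥ []      j       le       = refl
nthM-≥ (x ∷ r) (suc j) (s≤s le) = nthM-≥ r j le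

-- The first row of the block has length `firstPart λ′`, exactly the distance by which `placed`
-- moves the next piece to the right.
block-nothingBelow : ∀ s λ′ F → HasShape λ′ F →
                     NothingBelow (s + firstPart λ′) (map (s +_) (zeros F)) F
block-nothingBelow s .[]                   []      refl c le = refl
block-nothingBelow s .(map length (r ∷ F)) (r ∷ F) refl c le
  rewrite +-identityʳ s | ≤ᵇ-true (≤-trans (m≤m+n s (length r)) le) =
  nthM-≥ r (c ∸ s) (≤-trans (≤-reflexive (sym (m+n∸m≡n s (length r)))) (∸-monoˡ-≤ s le))

unique-++⁻ˡ : ∀ (xs {ys} : List ℕ) → Unique (xs ++ ys) → Unique xs
unique-++⁻ˡ []       u       = []
unique-++⁻ˡ (x ∷ xs) (p ∷ u) = All.++⁻ˡ xs p ∷ unique-++⁻ˡ xs u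

unique-++⁻ʳ : ∀ (xs {ys} : List ℕ) → Unique (xs ++ ys) → Unique ys
unique-++⁻ʳ []       u       = u
unique-++⁻ʳ (x ∷ xs) (_ ∷ u) = unique-++⁻ʳ xs u

unique-++-disjoint : ∀ (xs {ys} : List ℕ) {v} → Unique (xs ++ ys) → v ∈ xs → v ∉ ys
unique-++-disjoint (x ∷ xs) (p ∷ _) (here refl) v∈ys = All.lookup (All.++⁻ʳ xs p) v∈ys refl
unique-++-disjoint (x ∷ xs) (_ ∷ u) (there v∈)  v∈ys = unique-++-disjoint xs u v∈ v∈ys

-- Peels off the bottom piece, which is the head of the list because `unionFilling` reverses it.
-- Distinct entries ensure that at most one piece contains `v`.
evict-union : ∀ f v top s ls Fs → Pointwise HasShape ls Fs → cells (unionFilling Fs) ≤ f →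
              Unique (concat (unionFilling Fs)) →
              evict f v top (placedOffsets s ls) (unionFilling Fs) ≡
              unionFilling (map (evict₀ v top) Fs)
evict-union f v top s []        []       []         le dist = refl
evict-union f v top s (λ′ ∷ ls) (F ∷ Fs) (sh ∷ shs) le dist
  rewrite placedOffsets-∷ s λ′ ls F sh
        | concat-reverse-∷ F Fs
        | concat-reverse-∷ (evict₀ v top F) (map (evict₀ v top) Fs)
        = begin
  evict f v top (os ++ map (s +_) (zeros F)) (V ++ F)
    ≡⟨ evict-++ f v top os (map (s +_) (zeros F)) V F (placedOffsets-length s′ ls Fs shs)
         (placedOffsets-≥ s′ ls) (block-nothingBelow s λ′ F sh)
         (unique-++-disjoint (concat V) dist′) ⟩
  evict f v top os V ++ evict f v top (map (s +_) (zeros F)) F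
    ≡⟨ cong₂ _++_ (evict-union f v top s′ ls Fs shs (m+n≤o⇒m≤o (cells V) le′) (unique-++⁻ˡ (concat V) dist′))
                  -- The column shift is removed before the fuel is reduced, since the fuel bound is
                  -- available for zero offsets only.
                  (trans (evict-shift f s v top (zeros F) F)
                         (evict-fuel v top F (zeros-0 F) (m+n≤o⇒n≤o (cells V) le′))) ⟩
  unionFilling (map (evict₀ v top) Fs) ++ evict₀ v top F ∎
  where
  open ≡-Reasoning
  s′ = s + firstPart λ′
  os = placedOffsets s′ ls
  V = unionFilling Fs
  le′ : cells V + cells F ≤ f
  le′ = ≤-trans (≤-reflexive (trans (sym (sum-++ (map length V) (map length F)))
                                    (cong sum (sym (map-++ length V F))))) le
  dist′ : Unique (concat V ++ concat F)
  dist′ = subst Unique (sym (concat-++ V F)) dist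

Standard : ℕ → Filling → Set
Standard n F = concat F ↭ map suc (upTo n)

cells≡length : ∀ F → cells F ≡ length (concat F)
cells≡length []      = refl
cells≡length (r ∷ F) = trans (cong (length r +_) (cells≡length F)) (sym (length-++ r))

standard-cells : ∀ {n} F → Standard n F → cells F ≡ n
standard-cells {n} F st =
  trans (cells≡length F) (trans (↭-length st) (trans (length-map suc (upTo n)) (length-upTo n)))

unique-resp-↭ : ∀ {xs ys : List ℕ} → xs ↭ ys → Unique xs → Unique ys
unique-resp-↭ p = Unique-resp-↭ (↭⇒↭ₛ p)

standard-unique : ∀ {n} F → Standard n F → Unique (concat F)
standard-unique {n} F st = unique-resp-↭ (↭-sym st) (Unique.map⁺ suc-injective (Unique.upTo⁺ n))

standard-1∈ : ∀ {n} F → 0 < n → Standard n F → 1 ∈ concat F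
standard-1∈ {suc n} F _ st = ∈-resp-↭ (↭-sym st) (here refl)

pr≡ : ∀ {n} sh F → 0 < n → length (offsets sh) ≡ length F → Standard n F →
      pr sh F ≡ mapF (_∸ 1) (evict n 1 (suc n) (offsets sh) F)
pr≡ {n} sh F n>0 len st
  with findCell 1 (offsets sh) F | findCell-∈ 1 (offsets sh) F len (standard-1∈ F n>0 st)
... | just (i , c) | _ rewrite standard-cells F st = refl
... | nothing      | _ , ()

evict-standard : ∀ {n} f os F → 0 < n → length os ≡ length F → Standard n F →
                 Standard n (mapF (_∸ 1) (evict f 1 (suc n) os F))
evict-standard {n} f os F n>0 len st = begin
  concat (mapF (_∸ 1) E)                ≡⟨ concat-map E ⟩
  map (_∸ 1) (concat E)                 ↭⟨ map⁺ (_∸ 1) (drop-∷ exchanged) ⟩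
  map (_∸ 1) (map suc (applyUpTo suc n)) ≡⟨ map-∘ (applyUpTo suc n) ⟨
  map id (applyUpTo suc n)              ≡⟨ map-id (applyUpTo suc n) ⟩
  applyUpTo suc n                       ≡⟨ map-upTo suc n ⟨
  map suc (upTo n)                      ∎
  where
  open PermutationReasoning
  E = evict f 1 (suc n) os F
  exchanged : 1 ∷ concat E ↭ map suc (upTo (suc n))
  exchanged = begin
    1 ∷ concat E                ↭⟨ evict-↭ f 1 (suc n) os F len (standard-1∈ F n>0 st) ⟩
    suc n ∷ concat F            ↭⟨ prep (suc n) st ⟩
    suc n ∷ map suc (upTo n)    ↭⟨ ∷↭∷ʳ (suc n) (map suc (upTo n)) ⟩
    map suc (upTo n) ++ [ suc n ] ≡⟨ map-++ suc (upTo n) [ n ] ⟨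
    map suc (upTo n ++ [ n ])   ≡⟨ cong (map suc) (upTo-∷ʳ n) ⟩
    map suc (upTo (suc n))      ∎

mapF-union : ∀ φ Fs → mapF φ (unionFilling Fs) ≡ unionFilling (map (mapF φ) Fs)
mapF-union φ Fs = trans (sym (concat-map (reverse Fs))) (cong concat (reverse-map (mapF φ) Fs))

pr-union : ∀ {n} ls Fs → 0 < n → Pointwise HasShape ls Fs → Standard n (unionFilling Fs) →
           pr (unionShape ls) (unionFilling Fs) ≡ unionFilling (map (step n) Fs)
pr-union {n} ls Fs n>0 shs st = begin
  pr (unionShape ls) (unionFilling Fs)
    ≡⟨ pr≡ (unionShape ls) (unionFilling Fs) n>0 (placedOffsets-length 0 ls Fs shs) st ⟩
  mapF (_∸ 1) (evict n 1 (suc n) (placedOffsets 0 ls) (unionFilling Fs))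
    ≡⟨ cong (mapF (_∸ 1)) (evict-union n 1 (suc n) 0 ls Fs shs
         (≤-reflexive (standard-cells (unionFilling Fs) st)) (standard-unique (unionFilling Fs) st)) ⟩
  mapF (_∸ 1) (unionFilling (map (evict₀ 1 (suc n)) Fs))
    ≡⟨ mapF-union (_∸ 1) (map (evict₀ 1 (suc n)) Fs) ⟩
  unionFilling (map (mapF (_∸ 1)) (map (evict₀ 1 (suc n)) Fs))
    ≡⟨ cong unionFilling (map-∘ Fs) ⟨
  unionFilling (map (step n) Fs) ∎
  where open ≡-Reasoning

iter-lengths : ∀ n t F → map length (iter t (step n) F) ≡ map length F
iter-lengths n zero    F = refl
iter-lengths n (suc t) F = trans (step-lengths n (iter t (step n) F)) (iter-lengths n t F)

iter-shape : ∀ n t {ls Fs} → Pointwise HasShape ls Fs → Pointwise HasShape ls (map (iter t (step n)) Fs)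
iter-shape n t []                     = []
iter-shape n t {Fs = F ∷ _} (sh ∷ shs) = trans (iter-lengths n t F) sh ∷ iter-shape n t shs

-- Standardness is carried through the induction because every single step needs it: the entry 1
-- must exist and the entries must be distinct.
iter-pr-union : ∀ {n} t ls Fs → 0 < n → Pointwise HasShape ls Fs → Standard n (unionFilling Fs) →
  iter t (pr (unionShape ls)) (unionFilling Fs) ≡ unionFilling (map (iter t (step n)) Fs)
  × Standard n (unionFilling (map (iter t (step n)) Fs))
iter-pr-union zero ls Fs n>0 shs st rewrite map-id Fs = refl , st
iter-pr-union {n} (suc t) ls Fs n>0 shs st with iter-pr-union t ls Fs n>0 shs st
... | eq , st′ = trans (cong (pr (unionShape ls)) eq) pr-Gs ,
                 subst (Standard n) (trans (sym (pr≡ (unionShape ls) G n>0 len st′)) pr-Gs)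
                   (evict-standard n (offsets (unionShape ls)) G n>0 len st′)
  where
  Gs = map (iter t (step n)) Fs
  G = unionFilling Gs
  shs′ = iter-shape n t shs
  len : length (offsets (unionShape ls)) ≡ length G
  len = placedOffsets-length 0 ls Gs shs′
  pr-Gs : pr (unionShape ls) G ≡ unionFilling (map (iter (suc t) (step n)) Fs)
  pr-Gs = trans (pr-union ls Gs n>0 shs′ st′) (cong unionFilling (sym (map-∘ Fs)))

-- A straight shape is a union with one piece, up to a trailing `[]`.
iter-pr-straight : ∀ {n} t λ′ T → 0 < n → HasShape λ′ T → Standard n T →
                   iter t (pr (straight λ′)) T ≡ iter t (step n) T
iter-pr-straight {n} t λ′ T n>0 sh st
  with iter-pr-union {n} t (λ′ ∷ []) (T ∷ []) n>0 (sh ∷ [])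
         (subst (Standard n) (sym (++-identityʳ T)) st)
... | eq , _ rewrite ++-identityʳ T | ++-identityʳ (iter t (step n) T) | ++-identityʳ (straight λ′) = eq

-- The orbit of one piece

applyUpTo-cong : ∀ {f g : ℕ → ℕ} → (∀ x → f x ≡ g x) → ∀ n → applyUpTo f n ≡ applyUpTo g n
applyUpTo-cong f≗g zero    = refl
applyUpTo-cong f≗g (suc n) = cong₂ _∷_ (f≗g 0) (applyUpTo-cong (λ x → f≗g (suc x)) n)

-- Iterated promotion of T, with entries 0, …, N - 1, without decrements: after c steps
-- the entries are c, …, c + N - 1.
undecremented : Filling → ℕ → Filling
undecremented T zero    = T
undecremented T (suc c) = evict₀ c (c + cells T) (undecremented T c)

undecremented-↭ : ∀ T c → 0 < cells T → concat T ↭ upTo (cells T) →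
                  concat (undecremented T c) ↭ applyUpTo (c +_) (cells T)
undecremented-↭ T zero    N>0 st = st
undecremented-↭ T (suc c) N>0 st = drop-∷ (begin
  c ∷ concat (undecremented T (suc c))       ↭⟨ evict₀-↭ c (c + cells T) (undecremented T c) (c∈ N>0) ⟩
  c + cells T ∷ concat (undecremented T c)   ↭⟨ prep _ ih ⟩
  c + cells T ∷ applyUpTo (c +_) (cells T)   ↭⟨ ∷↭∷ʳ (c + cells T) _ ⟩
  applyUpTo (c +_) (cells T) ++ [ c + cells T ] ≡⟨ applyUpTo-∷ʳ (c +_) (cells T) ⟩
  c + 0 ∷ applyUpTo (λ x → c + suc x) (cells T) ≡⟨ cong₂ _∷_ (+-identityʳ c) (applyUpTo-cong (+-suc c) (cells T)) ⟩
  c ∷ applyUpTo (suc c +_) (cells T)         ∎)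
  where
  open PermutationReasoning
  ih = undecremented-↭ T c N>0 st
  c∈ : 0 < cells T → c ∈ concat (undecremented T c)
  c∈ N>0 with suc N ← cells T | ih′ ← ih = ∈-resp-↭ (↭-sym ih′) (here (sym (+-identityʳ c)))

mapF-∘ : ∀ φ ψ F → mapF φ (mapF ψ F) ≡ mapF (φ ∘ ψ) F
mapF-∘ φ ψ F = trans (sym (map-∘ F)) (map-cong (λ r → sym (map-∘ r)) F)

mapF-cong : ∀ {φ ψ} → (∀ x → φ x ≡ ψ x) → ∀ F → mapF φ F ≡ mapF ψ F
mapF-cong eq = map-cong (map-cong eq)

-- Truncated subtraction loses information at 0, hence the positivity.
restore-decrement : ∀ t G → All (0 <_) (concat G) → mapF (suc t +_) (mapF (_∸ 1) G) ≡ mapF (t +_) G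
restore-decrement t G pos = trans (mapF-∘ (suc t +_) (_∸ 1) G) (rows G (All.concat⁻ pos))
  where
  row : ∀ r → All (0 <_) r → map ((suc t +_) ∘ (_∸ 1)) r ≡ map (t +_) r
  row []          []       = refl
  row (suc x ∷ r) (_ ∷ ps) = cong₂ _∷_ (sym (+-suc t x)) (row r ps)
  rows : ∀ F → All (All (0 <_)) F → mapF ((suc t +_) ∘ (_∸ 1)) F ≡ mapF (t +_) F
  rows []      []       = refl
  rows (r ∷ F) (p ∷ ps) = cong₂ _∷_ (row r p) (rows F ps)

applyUpTo-injective : ∀ {f g : ℕ → ℕ} n → applyUpTo f n ≡ applyUpTo g n → ∀ {x} → x < n → f x ≡ g x
applyUpTo-injective (suc n) eq {zero}  _         = ∷-injectiveˡ eq
applyUpTo-injective (suc n) eq {suc x} (s≤s x<n) = applyUpTo-injective n (∷-injectiveʳ eq) x<n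

sorted-↭⇒≡ : ∀ {xs ys} → Linked _<_ xs → Linked _<_ ys → xs ↭ ys → xs ≡ ys
sorted-↭⇒≡ xs↗ ys↗ p = Pointwise-≡⇒≡ (↗↭↗⇒≋ ≤-totalOrder (Linked.map <⇒≤ xs↗) (Linked.map <⇒≤ ys↗) (↭⇒↭ₛ p))

strictMono-applyUpTo : ∀ {f} → StrictMono f → ∀ n → Linked _<_ (applyUpTo f n)
strictMono-applyUpTo mono n = Linked.applyUpTo⁺₂ _ n (λ i → mono (n<1+n i))

applyUpTo-↭⇒≗ : ∀ {f g n} → StrictMono f → StrictMono g → applyUpTo f n ↭ applyUpTo g n →
                ∀ {x} → x < n → f x ≡ g x
applyUpTo-↭⇒≗ {n = n} fm gm p =
  applyUpTo-injective n (sorted-↭⇒≡ (strictMono-applyUpTo fm n) (strictMono-applyUpTo gm n) p)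

-- Identities between functions that grow by a constant over each period need to be checked on one
-- period only.
period-induction : ∀ {N} {P : ℕ → Set} → 0 < N → (∀ x → x < N → P x) → (∀ x → P x → P (x + N)) → ∀ x → P x
period-induction {N} {P} N>0 base next = <-rec P go
  where
  go : ∀ x → (∀ {y} → y < x → P y) → P x
  go x ih with x <? N
  ... | yes x<N = base x x<N
  ... | no  x≮N = subst P (m∸n+n≡m (≮⇒≥ x≮N))
                    (next (x ∸ N) (ih (∸-monoʳ-< N>0 (≮⇒≥ x≮N))))

module Orbit {n : ℕ} {β : ℕ → ℕ} (mono : StrictMono β) (T : Filling)
             (N>0 : 0 < cells T) (content : concat T ↭ upTo (cells T))
             (period : ∀ x → β (x + cells T) ≡ β x + n) (β0>0 : 0 < β 0) where

  orbit : ℕ → Filling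
  orbit t = iter t (step n) (mapF β T)

  undecremented-≥ : ∀ c → All (β c ≤_) (concat (mapF β (undecremented T c)))
  undecremented-≥ c rewrite concat-map {f = β} (undecremented T c) =
    All.map⁺ (All-resp-↭ (↭-sym (undecremented-↭ T c N>0 content))
      (All.applyUpTo⁺₂ (c +_) (cells T) (λ x → mono-≤ mono (m≤m+n c x))))

  -- Used with `b = 1` to undo the truncated decrement and with `b = 2` to exclude the entry 1.
  lower-bound : ∀ t {c G} b → mapF (t +_) G ≡ mapF β (undecremented T c) → t + b ≤ β c → All (b ≤_) (concat G)
  lower-bound t {c} {G} b eq le = All.map (+-cancelˡ-≤ t b _) (All.map⁻
    (subst (All (t + b ≤_)) (trans (cong concat (sym eq)) (concat-map G))
      (All.map (≤-trans le) (undecremented-≥ c))))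

  -- Here c counts the labels β x ≤ t; these are the evictions affecting the piece up to time t.
  Tracks : ℕ → ℕ → Set
  Tracks t c = mapF (t +_) (orbit t) ≡ mapF β (undecremented T c)
             × t < β c × (∀ {x} → x < c → β x ≤ t)

  -- The least entry of `mapF β (undecremented T c)` is `β c`. If `t + 1 < β c`, the entry 1 is not
  -- in this piece and the step is a pure decrement; if `t + 1 = β c`, the piece itself is promoted
  -- and `c` grows by one.
  tracks : ∀ t → ∃ (Tracks t)
  tracks zero = 0 , trans (mapF-cong (λ _ → refl) _) (trans (map-cong map-id _) (map-id _)) , β0>0 , λ ()
  tracks (suc t) with tracks t
  ... | c , eq , t<βc , below with m≤n⇒m<n∨m≡n t<βc
  ...   | inj₁ 1+t<βc = c , trans restored eq , 1+t<βc , λ x<c → m≤n⇒m≤1+n (below x<c)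
    where
    1∉ : 1 ∉ concat (orbit t)
    1∉ 1∈ = <-irrefl refl (All.lookup
      (lower-bound t 2 eq (≤-trans (≤-reflexive (trans (+-suc t 1) (cong suc (+-comm t 1)))) 1+t<βc)) 1∈)
    restored : mapF (suc t +_) (orbit (suc t)) ≡ mapF (t +_) (orbit t)
    restored = trans
      (cong (mapF (suc t +_) ∘ mapF (_∸ 1)) (evict-∉ _ 1 (suc n) (zeros (orbit t)) (orbit t) 1∉))
      (restore-decrement t (orbit t) (lower-bound t 1 eq (≤-trans (≤-reflexive (+-comm t 1)) t<βc)))
  ...   | inj₂ 1+t≡βc = suc c , trans (restore-decrement t E (lower-bound t 1 evicted
                            (≤-trans (≤-reflexive (trans (+-comm t 1) 1+t≡βc)) (<⇒≤ (mono (n<1+n c)))))) evicted ,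
                        ≤-<-trans (≤-reflexive 1+t≡βc) (mono (n<1+n c)) ,
                        λ x<1+c → ≤-trans (mono-≤ mono (≤-pred x<1+c)) (≤-reflexive (sym 1+t≡βc))
    where
    open ≡-Reasoning
    E = evict₀ 1 (suc n) (orbit t)
    inserted : t + suc n ≡ β (c + cells T)
    inserted = trans (+-suc t n) (trans (cong (_+ n) 1+t≡βc) (sym (period c)))
    evicted : mapF (t +_) E ≡ mapF β (undecremented T (suc c))
    evicted = begin
      mapF (t +_) E
        ≡⟨ evict₀-map (+-monoʳ-< t) 1 (suc n) (orbit t) ⟨
      evict₀ (t + 1) (t + suc n) (mapF (t +_) (orbit t))
        ≡⟨ cong (evict₀ (t + 1) (t + suc n)) eq ⟩
      evict₀ (t + 1) (t + suc n) (mapF β (undecremented T c))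
        ≡⟨ cong₂ (λ v top → evict₀ v top (mapF β (undecremented T c))) (trans (+-comm t 1) 1+t≡βc) inserted ⟩
      evict₀ (β c) (β (c + cells T)) (mapF β (undecremented T c))
        ≡⟨ evict₀-map mono c (c + cells T) (undecremented T c) ⟩
      mapF β (undecremented T (suc c)) ∎

  Shifts : ℕ → ℕ → Set
  Shifts m c = ∀ x → β (c + x) ≡ m + β x

  shifted : ∀ {m c} → Shifts m c → mapF (m +_) (mapF β T) ≡ mapF β (mapF (c +_) T)
  shifted {m} {c} sh = begin
    mapF (m +_) (mapF β T)  ≡⟨ mapF-∘ (m +_) β T ⟩
    mapF (λ x → m + β x) T  ≡⟨ mapF-cong sh T ⟨
    mapF (λ x → β (c + x)) T ≡⟨ mapF-∘ β (c +_) T ⟨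
    mapF β (mapF (c +_) T)  ∎
    where open ≡-Reasoning

  -- Given `Shifts m c`, both sides of the tracking equation are `β` applied to a filling, and `β`
  -- cancels. Together with the converse below this lets a fixed point be transferred between
  -- different labellings of the same `T`.
  fixed⇒undecremented : ∀ {m c} → Tracks m c → Shifts m c → orbit m ≡ mapF β T →
                        undecremented T c ≡ mapF (c +_) T
  fixed⇒undecremented {m} (eq , _) sh fix =
    mapF-injective mono (trans (sym eq) (trans (cong (mapF (m +_)) fix) (shifted sh)))

  undecremented⇒fixed : ∀ {m c} → Tracks m c → Shifts m c →
                        undecremented T c ≡ mapF (c +_) T → orbit m ≡ mapF β T
  undecremented⇒fixed {m} (eq , _) sh und =
    mapF-injective (+-monoʳ-< m) (trans eq (trans (cong (mapF β) und) (sym (shifted sh))))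

  -- Both sides of the hypothesis have a sorted content, so the contents agree entrywise.
  fixed⇒shifts : ∀ {m c} → Tracks m c → orbit m ≡ mapF β T → Shifts m c
  fixed⇒shifts {m} {c} (eq , _) fix = extend
    where
    N = cells T
    content-mapF : ∀ (φ : ℕ → ℕ) {ψ : ℕ → ℕ} F → concat F ↭ applyUpTo ψ N → concat (mapF φ F) ↭ applyUpTo (φ ∘ ψ) N
    content-mapF φ {ψ} F p = begin
      concat (mapF φ F)       ≡⟨ concat-map F ⟩
      map φ (concat F)        ↭⟨ map⁺ φ p ⟩
      map φ (applyUpTo ψ N)   ≡⟨ map-applyUpTo ψ φ N ⟩
      applyUpTo (φ ∘ ψ) N     ∎
      where open PermutationReasoning
    same-content : applyUpTo (λ x → β (c + x)) N ↭ applyUpTo (λ x → m + β x) N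
    same-content = begin
      applyUpTo (λ x → β (c + x)) N         ↭⟨ content-mapF β (undecremented T c) (undecremented-↭ T c N>0 content) ⟨
      concat (mapF β (undecremented T c))   ≡⟨ cong concat eq ⟨
      concat (mapF (m +_) (orbit m))        ≡⟨ cong (concat ∘ mapF (m +_)) fix ⟩
      concat (mapF (m +_) (mapF β T))       ↭⟨ content-mapF (m +_) (mapF β T) (content-mapF β T content) ⟩
      applyUpTo (λ x → m + β x) N           ∎
      where open PermutationReasoning
    -- The contents give equality for `x < N`; beyond that both sides gain `n` whenever `x` grows by
    -- `N`.
    extend : Shifts m c
    extend = period-induction N>0
      (λ x x<N → applyUpTo-↭⇒≗ (λ lt → mono (+-monoʳ-< c lt)) (λ lt → +-monoʳ-< m (mono lt)) same-content x<N)
      λ y ih → begin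
        β (c + (y + N))   ≡⟨ cong β (+-assoc c y N) ⟨
        β (c + y + N)     ≡⟨ period (c + y) ⟩
        β (c + y) + n     ≡⟨ cong (_+ n) ih ⟩
        m + β y + n       ≡⟨ +-assoc m (β y) n ⟩
        m + (β y + n)     ≡⟨ cong (m +_) (period y) ⟨
        m + β (y + N)     ∎
      where open ≡-Reasoning

-- Labellings

strictMono-suc : ∀ {φ} → (∀ x → φ x < φ (suc x)) → StrictMono φ
strictMono-suc {φ} step< {x} {y} x<y = go (≤⇒≤′ x<y)
  where
  go : ∀ {y} → suc x ≤′ y → φ x < φ y
  go ≤′-refl      = step< x
  go (≤′-step le) = <-trans (go le) (step< _)

-- It suffices to compare neighbours inside one period and across the seam to the next.
strictMono-periodic : ∀ {φ p m} → 0 < p → (∀ x → φ (x + p) ≡ φ x + m) →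
  (∀ x → suc x < p → φ x < φ (suc x)) → (∀ x → suc x ≡ p → φ x < φ p) → StrictMono φ
strictMono-periodic {φ} {p} {m} p>0 period inner last = strictMono-suc
  (period-induction p>0 base λ x ih → subst₂ _<_ (sym (period x)) (sym (period (suc x))) (+-monoˡ-< m ih))
  where
  base : ∀ x → x < p → φ x < φ (suc x)
  base x x<p with m≤n⇒m<n∨m≡n x<p
  ... | inj₁ 1+x<p = inner x 1+x<p
  ... | inj₂ 1+x≡p = <-≤-trans (last x 1+x≡p) (≤-reflexive (cong φ (sym 1+x≡p)))

nth0-∈ : ∀ M x → x < length M → nth0 M x ∈ M
nth0-∈ (a ∷ M) zero    _         = here refl
nth0-∈ (a ∷ M) (suc x) (s≤s x<) = there (nth0-∈ M x x<)

nth0-< : ∀ M x → Linked _<_ M → suc x < length M → nth0 M x < nth0 M (suc x)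
nth0-< (a ∷ [])    x       [-]       (s≤s ())
nth0-< (a ∷ b ∷ M) zero    (a<b ∷ _) _         = a<b
nth0-< (a ∷ b ∷ M) (suc x) (_ ∷ M↗)  (s≤s x<) = nth0-< (b ∷ M) x M↗ x<

nth0-applyUpTo : ∀ M → applyUpTo (nth0 M) (length M) ≡ M
nth0-applyUpTo []      = refl
nth0-applyUpTo (a ∷ M) = cong (a ∷_) (nth0-applyUpTo M)

applyUpTo-cong-< : ∀ {f g : ℕ → ℕ} n → (∀ x → x < n → f x ≡ g x) → applyUpTo f n ≡ applyUpTo g n
applyUpTo-cong-< zero    f≗g = refl
applyUpTo-cong-< (suc n) f≗g = cong₂ _∷_ (f≗g 0 z<s) (applyUpTo-cong-< n (λ x x<n → f≗g (suc x) (s≤s x<n)))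

-- Indexed from 0, while the entries of a tableau are indexed from 1.
label : ℕ → List ℕ → ℕ → ℕ
label m M x = Ientry m M (suc x)

label-period : ∀ m M → 0 < length M → ∀ x → label m M (x + length M) ≡ label m M x + m
label-period m M@(a ∷ A) _ x = begin
  (x + p) / p * m + nth0 M ((x + p) % p)  ≡⟨ cong₂ (λ q r → q * m + nth0 M r) quotient ([m+n]%n≡m%n x p) ⟩
  suc (x / p) * m + nth0 M (x % p)        ≡⟨ +-assoc m (x / p * m) _ ⟩
  m + (x / p * m + nth0 M (x % p))        ≡⟨ +-comm m _ ⟩
  x / p * m + nth0 M (x % p) + m          ∎
  where
  open ≡-Reasoning
  p = length M
  quotient : (x + p) / p ≡ suc (x / p)
  quotient = trans (+-distrib-/-∣ʳ x (∣-refl {p})) (trans (cong (x / p +_) (n/n≡1 p)) (+-comm (x / p) 1))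

label-< : ∀ m M x → x < length M → label m M x ≡ nth0 M x
label-< m M@(a ∷ A) x x< rewrite m<n⇒m/n≡0 x< | m<n⇒m%n≡m x< = refl

label-applyUpTo : ∀ m M → applyUpTo (label m M) (length M) ≡ M
label-applyUpTo m M = trans (applyUpTo-cong-< (length M) (label-< m M)) (nth0-applyUpTo M)

InRange : ℕ → ℕ → Set
InRange m x = 0 < x × x ≤ m

label-range : ∀ {m} M x → All (InRange m) M → x < length M → InRange m (label m M x)
label-range {m} M x range x< = subst (InRange m) (sym (label-< m M x x<)) (All.lookup range (nth0-∈ M x x<))

-- At the seam the last label of a block is at most `m`, and the next block starts at `m` plus a
-- positive label. For empty `M` the default case of `Ientry` makes `label` the successor.
label-mono : ∀ {m} M → Linked _<_ M → All (InRange m) M → StrictMono (label m M)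
label-mono     []        M↗ range = s≤s
label-mono {m} M@(_ ∷ _) M↗ range = strictMono-periodic {p = length M} z<s (label-period m M z<s)
  (λ x 1+x< → subst₂ _<_ (sym (label-< m M x (<-trans (n<1+n x) 1+x<))) (sym (label-< m M (suc x) 1+x<))
                     (nth0-< M x M↗ 1+x<))
  (λ x 1+x≡ → ≤-<-trans (proj₂ (label-range M x range (≤-reflexive 1+x≡)))
    (<-≤-trans (m<n+m m (proj₁ (label-range M 0 range z<s))) (≤-reflexive (sym (label-period m M z<s 0)))))

period-multiple : ∀ {φ p m} → (∀ x → φ (x + p) ≡ φ x + m) → ∀ k x → φ (x + k * p) ≡ φ x + k * m
period-multiple {φ} {p} {m} period zero    x = trans (cong φ (+-identityʳ x)) (sym (+-identityʳ (φ x)))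
period-multiple {φ} {p} {m} period (suc k) x = begin
  φ (x + (p + k * p))  ≡⟨ cong φ (+-assoc x p (k * p)) ⟨
  φ (x + p + k * p)    ≡⟨ period-multiple {φ} period k (x + p) ⟩
  φ (x + p) + k * m    ≡⟨ cong (_+ k * m) (period x) ⟩
  φ x + m + k * m      ≡⟨ +-assoc (φ x) m (k * m) ⟩
  φ x + (m + k * m)    ∎
  where open ≡-Reasoning

applyUpTo-+ : ∀ (f : ℕ → ℕ) a b → applyUpTo f (a + b) ≡ applyUpTo f a ++ applyUpTo (λ x → f (a + x)) b
applyUpTo-+ f zero    b = refl
applyUpTo-+ f (suc a) b = cong (f 0 ∷_) (applyUpTo-+ (f ∘ suc) a b)

-- The content of `I m M T`, expressed through `M` alone. Contents of several pieces can thus be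
-- added up before it is used that the label sets partition `[m]`.
translates : ℕ → ℕ → List ℕ → List ℕ
translates zero    m M = []
translates (suc k) m M = M ++ map (m +_) (translates k m M)

-- Applied to the labelling of one piece, and to `suc` with `p = m`, where it says that the
-- translates of `[m]` tile `[k * m]`.
applyUpTo-translates : ∀ {φ p m} → (∀ x → φ (x + p) ≡ φ x + m) → ∀ k →
                       applyUpTo φ (k * p) ≡ translates k m (applyUpTo φ p)
applyUpTo-translates {φ} {p} {m} period zero    = refl
applyUpTo-translates {φ} {p} {m} period (suc k) = begin
  applyUpTo φ (p + k * p)
    ≡⟨ applyUpTo-+ φ p (k * p) ⟩
  applyUpTo φ p ++ applyUpTo (λ x → φ (p + x)) (k * p)
    ≡⟨ cong (applyUpTo φ p ++_) (applyUpTo-cong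
         (λ x → trans (cong φ (+-comm p x)) (trans (period x) (+-comm (φ x) m))) (k * p)) ⟩
  applyUpTo φ p ++ applyUpTo (λ x → m + φ x) (k * p)
    ≡⟨ cong (applyUpTo φ p ++_) (map-applyUpTo φ (m +_) (k * p)) ⟨
  applyUpTo φ p ++ map (m +_) (applyUpTo φ (k * p))
    ≡⟨ cong (λ ys → applyUpTo φ p ++ map (m +_) ys) (applyUpTo-translates {φ} period k) ⟩
  applyUpTo φ p ++ map (m +_) (translates k m (applyUpTo φ p)) ∎
  where open ≡-Reasoning

translates-↭ : ∀ k m {xs ys} → xs ↭ ys → translates k m xs ↭ translates k m ys
translates-↭ zero    m p = refl
translates-↭ (suc k) m p = ++⁺ p (map⁺ (m +_) (translates-↭ k m p))

++-interchange-↭ : ∀ (ws xs ys zs : List ℕ) → (ws ++ xs) ++ (ys ++ zs) ↭ (ws ++ ys) ++ (xs ++ zs)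
++-interchange-↭ ws xs ys zs = begin
  (ws ++ xs) ++ (ys ++ zs)  ≡⟨ ++-assoc ws xs (ys ++ zs) ⟩
  ws ++ xs ++ ys ++ zs      ↭⟨ ++⁺ˡ ws (shifts xs ys) ⟩
  ws ++ ys ++ xs ++ zs      ≡⟨ ++-assoc ws ys (xs ++ zs) ⟨
  (ws ++ ys) ++ (xs ++ zs)  ∎
  where open PermutationReasoning

translates-++ : ∀ k m xs ys → translates k m (xs ++ ys) ↭ translates k m xs ++ translates k m ys
translates-++ zero    m xs ys = refl
translates-++ (suc k) m xs ys = begin
  (xs ++ ys) ++ map (m +_) (translates k m (xs ++ ys))
    ↭⟨ ++⁺ˡ (xs ++ ys) (map⁺ (m +_) (translates-++ k m xs ys)) ⟩
  (xs ++ ys) ++ map (m +_) (translates k m xs ++ translates k m ys)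
    ≡⟨ cong ((xs ++ ys) ++_) (map-++ (m +_) (translates k m xs) _) ⟩
  (xs ++ ys) ++ (map (m +_) (translates k m xs) ++ map (m +_) (translates k m ys))
    ↭⟨ ++-interchange-↭ xs ys _ _ ⟩
  translates (suc k) m xs ++ translates (suc k) m ys ∎
  where open PermutationReasoning

-- A single piece

ColumnsIncrease : List ℕ → Filling → Set
ColumnsIncrease os F = ∀ i c x y → get os F i c ≡ just x → get os F (suc i) c ≡ just y → x < y

Increasing : Filling → Set
Increasing F = All (Linked _<_) F × ColumnsIncrease (zeros F) F

mapM-just : ∀ {φ : ℕ → ℕ} ma {y} → mapM φ ma ≡ just y → ∃ λ x → ma ≡ just x × φ x ≡ y
mapM-just (just x) refl = x , refl , refl

increasing-mapF⁺ : ∀ {φ} → StrictMono φ → ∀ F → Increasing F → Increasing (mapF φ F)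
increasing-mapF⁺ {φ} mono F (rows , columns) =
  All.map⁺ (All.map (Linked.map⁺ ∘ Linked.map mono) rows) , columns′
  where
  columns′ : ColumnsIncrease (zeros (mapF φ F)) (mapF φ F)
  columns′ i c x y e₁ e₂
    rewrite zeros-cong (mapF φ F) F (mapF-lengths φ F) | get-map φ (zeros F) F i c | get-map φ (zeros F) F (suc i) c
    with mapM-just (get (zeros F) F i c) e₁ | mapM-just (get (zeros F) F (suc i) c) e₂
  ... | x′ , e₁′ , refl | y′ , e₂′ , refl = mono (columns i c x′ y′ e₁′ e₂′)

increasing-mapF⁻ : ∀ {φ} → StrictMono φ → ∀ F → Increasing (mapF φ F) → Increasing F
increasing-mapF⁻ {φ} mono F (rows , columns) =
  All.map (Linked.map (mono-reflects-< mono) ∘ Linked.map⁻) (All.map⁻ rows) , columns′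
  where
  entry : ∀ {i c x} → get (zeros F) F i c ≡ just x → get (zeros (mapF φ F)) (mapF φ F) i c ≡ just (φ x)
  entry {i} {c} e rewrite zeros-cong (mapF φ F) F (mapF-lengths φ F) | get-map φ (zeros F) F i c | e = refl
  columns′ : ColumnsIncrease (zeros F) F
  columns′ i c x y e₁ e₂ = mono-reflects-< mono (columns i c (φ x) (φ y) (entry {i} e₁) (entry {suc i} e₂))

straight-lengths : ∀ λ′ → map proj₂ (straight λ′) ≡ λ′
straight-lengths λ′ = trans (sym (map-∘ λ′)) (map-id λ′)

straight-offsets : ∀ F → offsets (straight (map length F)) ≡ zeros F
straight-offsets F = trans (row-offsets 0 (map length F) F refl) (map-id (zeros F))

straight-SYT⁺ : ∀ λ′ T → HasShape λ′ T → Standard (cells T) T → Increasing T → IsSYT (straight λ′) T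
straight-SYT⁺ .(map length T) T refl st (rows , columns) =
  sym lengths ,
  subst (λ l → Standard (sum l) T) (sym lengths) st ,
  rows ,
  subst (λ os → ColumnsIncrease os T) (sym (straight-offsets T)) columns
  where lengths = straight-lengths (map length T)

straight-SYT⁻ : ∀ λ′ T → IsSYT (straight λ′) T → HasShape λ′ T × Standard (cells T) T × Increasing T
straight-SYT⁻ λ′ T (lengths , st , rows , columns) with trans lengths (straight-lengths λ′)
... | refl = refl , subst (λ l → Standard (sum l) T) (sym lengths) st , rows ,
             subst (λ os → ColumnsIncrease os T) (straight-offsets T) columns

unmap : ∀ {φ} F → All (All (λ y → ∃ λ x → y ≡ φ x)) F → ∃ λ T → mapF φ T ≡ F
unmap {φ} [] [] = [] , refl
unmap {φ} (r ∷ F) (p ∷ ps) with row r p | unmap F ps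
  where
  row : ∀ r → All (λ y → ∃ λ x → y ≡ φ x) r → ∃ λ q → map φ q ≡ r
  row [] [] = [] , refl
  row (_ ∷ r) ((x , refl) ∷ p) with row r p
  ... | q , refl = x ∷ q , refl
... | q , refl | T , refl = q ∷ T , refl

-- Every entry lies in the image of `φ`, so preimages can be chosen entry by entry; injectivity then
-- determines the content of the result.
unlabel : ∀ {φ N} F → StrictMono φ → concat F ↭ applyUpTo φ N → ∃ λ T → mapF φ T ≡ F × concat T ↭ upTo N
unlabel {φ} {N} F mono p with unmap {φ} F (All.concat⁻ (All.tabulate λ {y} y∈ → labelled (∈-resp-↭ p y∈)))
  where
  labelled : ∀ {y} → y ∈ applyUpTo φ N → ∃ λ x → y ≡ φ x
  labelled y∈ with ∈-applyUpTo⁻ φ y∈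
  ... | x , _ , eq = x , eq
... | T , refl with ↭-map-inv φ (↭-trans (↭-reflexive (sym (concat-map T))) (↭-trans p (↭-reflexive (sym (map-upTo φ N)))))
...   | xs , eq , q = T , refl , ↭-trans q (↭-reflexive (sym (map-injective (mono-injective mono) eq)))

cells-mapF : ∀ φ F → cells (mapF φ F) ≡ cells F
cells-mapF φ F = cells-cong {mapF φ F} {F} (mapF-lengths φ F)

concat-mapF-↭ : ∀ φ T {N} → concat T ↭ upTo N → concat (mapF φ T) ↭ applyUpTo φ N
concat-mapF-↭ φ T {N} p = ↭-trans (↭-reflexive (concat-map T)) (↭-trans (map⁺ φ p) (↭-reflexive (map-upTo φ N)))

positive-parts-empty : ∀ {λ′} → All (0 <_) λ′ → sum λ′ ≡ 0 → λ′ ≡ []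
positive-parts-empty []              eq = refl
positive-parts-empty {suc _ ∷ _} (_ ∷ _) ()

-- Positive parts exclude fillings made of empty rows, which have no cells either.
empty-piece : ∀ {λ′} F → IsPartition λ′ → HasShape λ′ F → cells F ≡ 0 → F ≡ []
empty-piece F (_ , pos) sh N≡0 with positive-parts-empty pos (trans (cong sum (sym sh)) N≡0)
empty-piece [] _ _ _ | refl = refl

iter-fixed : ∀ {A : Set} {f : A → A} {x} → f x ≡ x → ∀ t → iter t f x ≡ x
iter-fixed eq zero    = refl
iter-fixed {f = f} eq (suc t) = trans (cong f (iter-fixed eq t)) eq

-- Ordinary promotion is the instance `β = suc`, `n = N` of `Orbit`. This translates the criterion
-- on `undecremented` into a statement on `pr` and back.
module Straight (T : Filling) (N>0 : 0 < cells T) (content : concat T ↭ upTo (cells T)) where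

  open Orbit {cells T} {suc} s≤s T N>0 content (λ _ → refl) z<s

  -- The labels 1, 2, 3, ... have no gaps, so every step evicts an entry of the piece and the count
  -- equals the time.
  tracks-suc : ∀ t → Tracks t t
  tracks-suc t with tracks t
  ... | c , eq , t<1+c , below with ≤-antisym (≤-pred t<1+c) (≮⇒≥ λ t<c → <-irrefl refl (below t<c))
  ...   | refl = eq , t<1+c , below

  shifts-suc : ∀ c → Shifts c c
  shifts-suc c x = sym (+-suc c x)

  standard : Standard (cells (mapF suc T)) (mapF suc T)
  standard rewrite cells-mapF suc T = ↭-trans (concat-mapF-↭ suc T content) (↭-reflexive (sym (map-upTo suc (cells T))))

  orbit-pr : ∀ {λ′} c → HasShape λ′ (mapF suc T) → iter c (pr (straight λ′)) (mapF suc T) ≡ orbit c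
  orbit-pr {λ′} c sh = trans
    (iter-pr-straight c λ′ (mapF suc T) (subst (0 <_) (sym (cells-mapF suc T)) N>0) sh standard)
    (cong (λ N → iter c (step N) (mapF suc T)) (cells-mapF suc T))

  pr-fixed⁺ : ∀ {λ′} c → HasShape λ′ (mapF suc T) → undecremented T c ≡ mapF (c +_) T →
              iter c (pr (straight λ′)) (mapF suc T) ≡ mapF suc T
  pr-fixed⁺ c sh und = trans (orbit-pr c sh) (undecremented⇒fixed (tracks-suc c) (shifts-suc c) und)

  pr-fixed⁻ : ∀ {λ′} c → HasShape λ′ (mapF suc T) → iter c (pr (straight λ′)) (mapF suc T) ≡ mapF suc T →
              undecremented T c ≡ mapF (c +_) T
  pr-fixed⁻ c sh fix = fixed⇒undecremented (tracks-suc c) (shifts-suc c) (trans (sym (orbit-pr c sh)) fix)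

linked-≤⇒< : ∀ {xs} → Linked _≤_ xs → Unique xs → Linked _<_ xs
linked-≤⇒< []        u                        = []
linked-≤⇒< [-]       u                        = [-]
linked-≤⇒< (le ∷ l) ((x≢y ∷ _) ∷ u) = ≤∧≢⇒< le x≢y ∷ linked-≤⇒< l u

filter-≤-applyUpTo : ∀ {φ m} c d → (∀ {x} → x < c → φ x ≤ m) → (∀ x → m < φ (c + x)) →
                     filter (_≤? m) (applyUpTo φ (c + d)) ≡ applyUpTo φ c
filter-≤-applyUpTo {φ} {m} c d small large = begin
  filter (_≤? m) (applyUpTo φ (c + d))
    ≡⟨ cong (filter (_≤? m)) (applyUpTo-+ φ c d) ⟩
  filter (_≤? m) (applyUpTo φ c ++ applyUpTo (λ x → φ (c + x)) d)
    ≡⟨ filter-++ (_≤? m) (applyUpTo φ c) _ ⟩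
  filter (_≤? m) (applyUpTo φ c) ++ filter (_≤? m) (applyUpTo (λ x → φ (c + x)) d)
    ≡⟨ cong₂ _++_ (filter-all (_≤? m) (All.applyUpTo⁺₁ φ c small))
                  (filter-none (_≤? m) (All.applyUpTo⁺₂ _ d (λ x → <⇒≱ (large x)))) ⟩
  applyUpTo φ c ++ []
    ≡⟨ ++-identityʳ (applyUpTo φ c) ⟩
  applyUpTo φ c ∎
  where open ≡-Reasoning

-- Two fields serve the global statement: `divisible` gives the divisibility of the gcd, and `small`
-- recovers the label set from the entries, which is how the label sets are seen to partition `[m]`.
record Decomposed (k m : ℕ) .{{_ : NonZero k}} (λ′ : Partition) (F : Filling) : Set where
  field
    tableau    : Filling
    labels     : List ℕ
    fixed      : FixedSYT (straight λ′) (∣ λ′ ∣ₚ / k) tableau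
    increasing : Linked _<_ labels
    length≡    : length labels ≡ ∣ λ′ ∣ₚ / k
    F≡         : F ≡ I m labels tableau
    divisible  : k ∣ ∣ λ′ ∣ₚ
    small      : filter (_≤? m) (concat F) ↭ labels

-- `Orbit` assumes at least one cell, so the empty piece is treated by hand.
decompose-[] : ∀ k m .{{_ : NonZero k}} → Decomposed k m [] []
decompose-[] k m = record
  { tableau = [] ; labels = [] ; increasing = [] ; length≡ = sym (0/n≡0 k) ; F≡ = refl ; divisible = k ∣0 ; small = refl
  ; fixed = (refl , refl , [] , λ _ _ _ _ ()) , iter-fixed refl (0 / k) }

module Decompose {k m n : ℕ} .{{_ : NonZero k}} (n≡km : n ≡ k * m) (F : Filling) (N>0 : 0 < cells F)
                 (inc : Increasing F) (unique : Unique (concat F)) (range : All (InRange n) (concat F))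
                 (fix : iter m (step n) F ≡ F) where

  A : List ℕ
  A = sort (concat F)

  A↭ : A ↭ concat F
  A↭ = sort-↭ (concat F)

  A↗ : Linked _<_ A
  A↗ = linked-≤⇒< (sort-↗ (concat F)) (unique-resp-↭ (↭-sym A↭) unique)

  A-range : All (InRange n) A
  A-range = All-resp-↭ (↭-sym A↭) range

  -- The extended labelling is again a `label`: with all entries of `F` as label set and `n` as
  -- increment, its period is `(N, n)`.
  φ : ℕ → ℕ
  φ = label n A

  φ-mono : StrictMono φ
  φ-mono = label-mono A A↗ A-range

  length-A : length A ≡ cells F
  length-A = trans (↭-length A↭) (sym (cells≡length F))

  N : ℕ
  N = cells F

  content-F : concat F ↭ applyUpTo φ N
  content-F = ↭-trans (↭-sym A↭) (↭-reflexive (trans (sym (label-applyUpTo n A)) (cong (applyUpTo φ) length-A)))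

  T₀ : Filling
  T₀ = proj₁ (unlabel F φ-mono content-F)

  F≡φT₀ : mapF φ T₀ ≡ F
  F≡φT₀ = proj₁ (proj₂ (unlabel F φ-mono content-F))

  cells-T₀ : cells T₀ ≡ N
  cells-T₀ = trans (sym (cells-mapF φ T₀)) (cong cells F≡φT₀)

  N₀>0 : 0 < cells T₀
  N₀>0 = subst (0 <_) (sym cells-T₀) N>0

  content : concat T₀ ↭ upTo (cells T₀)
  content = subst (λ N → concat T₀ ↭ upTo N) (sym cells-T₀) (proj₂ (proj₂ (unlabel F φ-mono content-F)))

  length>0 : 0 < length A
  length>0 = subst (0 <_) (sym length-A) N>0

  period : ∀ x → φ (x + cells T₀) ≡ φ x + n
  period x = trans (cong (λ N → φ (x + N)) (trans cells-T₀ (sym length-A))) (label-period n A length>0 x)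

  open Orbit φ-mono T₀ N₀>0 content period (proj₁ (label-range A 0 A-range length>0))
  open Straight T₀ N₀>0 content

  c : ℕ
  c = proj₁ (tracks m)

  tracked : Tracks m c
  tracked = proj₂ (tracks m)

  fix₀ : orbit m ≡ mapF φ T₀
  fix₀ = trans (cong (iter m (step n)) F≡φT₀) (trans fix (sym F≡φT₀))

  φ-shifts : Shifts m c
  φ-shifts = fixed⇒shifts tracked fix₀

  period-c : ∀ x → φ (x + c) ≡ φ x + m
  period-c x = trans (cong φ (+-comm x c)) (trans (φ-shifts x) (+-comm m (φ x)))

  -- The period (N, n) of φ is k times the period (c, m).
  kc≡N : k * c ≡ N
  kc≡N = trans (mono-injective φ-mono (trans (period-multiple {φ} period-c k 0)
    (trans (cong (φ 0 +_) (sym n≡km)) (sym (period 0))))) cells-T₀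

  c≡N/k : c ≡ N / k
  c≡N/k = trans (sym (m*n/n≡m c k)) (cong (_/ k) (trans (*-comm c k) kc≡N))

  c>0 : 0 < c
  c>0 = n≢0⇒n>0 λ c≡0 → <-irrefl (trans (sym (*-zeroʳ k)) (trans (cong (k *_) (sym c≡0)) kc≡N)) N>0

  M₀ : List ℕ
  M₀ = applyUpTo φ c

  length-M₀ : length M₀ ≡ c
  length-M₀ = length-applyUpTo φ c

  -- Both functions gain `m` over `c` steps, and they agree below `c` by the choice of `M₀`.
  label≗φ : ∀ x → label m M₀ x ≡ φ x
  label≗φ = period-induction c>0
    (λ x → applyUpTo-injective c (trans (cong (applyUpTo (label m M₀)) (sym length-M₀)) (label-applyUpTo m M₀)))
    λ x ih → begin
      label m M₀ (x + c)         ≡⟨ cong (λ l → label m M₀ (x + l)) length-M₀ ⟨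
      label m M₀ (x + length M₀) ≡⟨ label-period m M₀ (subst (0 <_) (sym length-M₀) c>0) x ⟩
      label m M₀ x + m           ≡⟨ cong (_+ m) ih ⟩
      φ x + m                    ≡⟨ period-c x ⟨
      φ (x + c)                  ∎
    where open ≡-Reasoning

  -- The tracking invariant places the threshold: labels with index below `c` are at most `m`, and
  -- `φ c` already exceeds `m`.
  small-labels : filter (_≤? m) (concat F) ↭ M₀
  small-labels = ↭-trans (filter-↭ (_≤? m) content-F) (↭-reflexive (trans
    (cong (filter (_≤? m) ∘ applyUpTo φ) (sym (m+[n∸m]≡n c≤N)))
    (filter-≤-applyUpTo c (N ∸ c) (proj₂ (proj₂ tracked))
      λ x → <-≤-trans (proj₁ (proj₂ tracked)) (mono-≤ φ-mono (m≤m+n c x)))))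
    where
    c≤N : c ≤ N
    c≤N = subst (c ≤_) kc≡N (m≤n*m c k)

  shape : map length (mapF suc T₀) ≡ map length F
  shape = trans (mapF-lengths suc T₀) (trans (sym (mapF-lengths φ T₀)) (cong (map length) F≡φT₀))

  decomposed : Decomposed k m (map length F) F
  decomposed = record
    { tableau    = mapF suc T₀
    ; labels     = M₀
    ; fixed      = straight-SYT⁺ (map length F) (mapF suc T₀) shape standard
                     (increasing-mapF⁺ s≤s T₀ (increasing-mapF⁻ φ-mono T₀ (subst Increasing (sym F≡φT₀) inc))) ,
                   -- The criterion `undecremented T₀ c ≡ mapF (c +_) T₀` was obtained with the
                   -- labelling `φ` and is reused with the labelling `suc`.
                   subst (λ e → iter e (pr (straight (map length F))) (mapF suc T₀) ≡ mapF suc T₀) c≡N/k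
                     (pr-fixed⁺ c shape (fixed⇒undecremented tracked φ-shifts fix₀))
    ; increasing = strictMono-applyUpTo φ-mono c
    ; length≡    = trans length-M₀ c≡N/k
    ; F≡         = sym (trans (mapF-∘ (Ientry m M₀) suc T₀) (trans (mapF-cong label≗φ T₀) F≡φT₀))
    ; divisible  = divides c (trans (sym kc≡N) (*-comm k c))
    ; small      = small-labels
    }

decompose : ∀ {k m n λ′} .{{_ : NonZero k}} F → n ≡ k * m → IsPartition λ′ → HasShape λ′ F →
            Increasing F → Unique (concat F) → All (InRange n) (concat F) → iter m (step n) F ≡ F →
            Decomposed k m λ′ F
decompose {k} {m} F n≡km part refl inc unique range fix with 0 <? cells F
... | yes N>0 = Decompose.decomposed n≡km F N>0 inc unique range fix
... | no  N≯0 with refl ← empty-piece F part refl (n≤0⇒n≡0 (≮⇒≥ N≯0)) = decompose-[] k m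

Composed : ℕ → ℕ → ℕ → Partition → List ℕ → Filling → Set
Composed k m n λ′ M F =
  HasShape λ′ F × Increasing F × iter m (step n) F ≡ F × concat F ↭ translates k m M

translates-[] : ∀ k m → translates k m [] ≡ []
translates-[] zero    m = refl
translates-[] (suc k) m = cong (map (m +_)) (translates-[] k m)

compose-[] : ∀ k m n → Composed k m n [] [] []
compose-[] k m n = refl , ([] , λ _ _ _ _ ()) , iter-fixed refl m , ↭-reflexive (sym (translates-[] k m))

module Compose {k m n : ℕ} .{{_ : NonZero k}} (n≡km : n ≡ k * m) (T₀ : Filling) (N>0 : 0 < cells T₀)
               (content : concat T₀ ↭ upTo (cells T₀)) (inc : Increasing (mapF suc T₀))
               (M : List ℕ) (M↗ : Linked _<_ M) (range : All (InRange m) M)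
               (k*length : k * length M ≡ cells T₀)
               (und : undecremented T₀ (length M) ≡ mapF (length M +_) T₀) where

  φ : ℕ → ℕ
  φ = label m M

  r : ℕ
  r = length M

  mono : StrictMono φ
  mono = label-mono M M↗ range

  r>0 : 0 < r
  r>0 = n≢0⇒n>0 λ r≡0 → <-irrefl (trans (sym (*-zeroʳ k)) (trans (cong (k *_) (sym r≡0)) k*length)) N>0

  period-r : ∀ x → φ (x + r) ≡ φ x + m
  period-r = label-period m M r>0

  period : ∀ x → φ (x + cells T₀) ≡ φ x + n
  period x = begin
    φ (x + cells T₀)  ≡⟨ cong (λ N → φ (x + N)) k*length ⟨
    φ (x + k * r)     ≡⟨ period-multiple {φ} period-r k x ⟩
    φ x + k * m       ≡⟨ cong (φ x +_) n≡km ⟨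
    φ x + n           ∎
    where open ≡-Reasoning

  φ0>0 : 0 < φ 0
  φ0>0 = proj₁ (label-range M 0 range r>0)

  open Orbit mono T₀ N>0 content period φ0>0

  φ-shifts : Shifts m r
  φ-shifts x = trans (cong φ (+-comm r x)) (trans (period-r x) (+-comm (φ x) m))

  -- The count reached at time `m` is `r`: labels with index below `r` belong to `M`, hence are at
  -- most `m`, while `φ r = φ 0 + m` exceeds `m`.
  tracked : Tracks m r
  tracked with tracks m
  ... | c , eq , m<φc , below with ≤-antisym r≤c c≤r
    where
    c≤r : c ≤ r
    c≤r = ≮⇒≥ λ r<c → <⇒≱ (<-≤-trans (m<n+m m φ0>0) (≤-reflexive (sym (period-r 0)))) (below r<c)
    r≤c : r ≤ c
    r≤c = ≮⇒≥ λ c<r → <⇒≱ m<φc (proj₂ (label-range M c range c<r))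
  ... | refl = eq , m<φc , below

  composed : Composed k m n (map length (mapF φ T₀)) M (mapF φ T₀)
  composed = refl ,
             increasing-mapF⁺ mono T₀ (increasing-mapF⁻ s≤s T₀ inc) ,
             undecremented⇒fixed tracked φ-shifts und ,
             ↭-trans (concat-mapF-↭ φ T₀ content) (↭-reflexive
               (trans (cong (applyUpTo φ) (sym k*length))
                 (trans (applyUpTo-translates {φ} period-r k) (cong (translates k m) (label-applyUpTo m M)))))

compose : ∀ {k m n λ′} .{{_ : NonZero k}} T M → n ≡ k * m → IsPartition λ′ → k ∣ ∣ λ′ ∣ₚ →
          FixedSYT (straight λ′) (∣ λ′ ∣ₚ / k) T → Linked _<_ M → All (InRange m) M →
          length M ≡ ∣ λ′ ∣ₚ / k → Composed k m n λ′ M (I m M T)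
compose {k} {m} {n} {λ′} T M n≡km part k∣ (syt , fix) M↗ range len with straight-SYT⁻ λ′ T syt
... | sh , st , inc with 0 <? cells T
compose {k} {m} {n} {λ′} T M n≡km part k∣ (syt , fix) M↗ range len | refl , st , inc | no N≯0
  with refl ← empty-piece T part refl (n≤0⇒n≡0 (≮⇒≥ N≯0))
  -- For an empty piece the prescribed number of labels is `0 / k`, so `M` is empty too.
  with M | trans len (0/n≡0 k)
... | [] | _ = compose-[] k m n
compose {k} {m} {n} {λ′} T M n≡km part k∣ (syt , fix) M↗ range len | sh , st , inc | yes N>0
  with unlabel T s≤s (↭-trans st (↭-reflexive (map-upTo suc (cells T))))
... | T₀ , refl , content rewrite cells-mapF suc T₀ =
  subst₂ (λ l F → Composed k m n l M F) shape (sym (mapF-∘ (Ientry m M) suc T₀))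
    (Compose.composed n≡km T₀ N>0 content inc M M↗ range k*length
      (Straight.pr-fixed⁻ T₀ N>0 content (length M) sh
        (subst (λ e → iter e (pr (straight λ′)) (mapF suc T₀) ≡ mapF suc T₀) (sym len) fix)))
  where
  shape : map length (mapF (label m M) T₀) ≡ λ′
  shape = trans (mapF-lengths (label m M) T₀) (trans (sym (mapF-lengths suc T₀)) sh)
  k*length : k * length M ≡ cells T₀
  k*length = trans (cong (k *_) len) (trans (*-comm k _) (trans (m/n*n≡m k∣)
    (trans (cong sum (sym sh)) (cells-mapF suc T₀))))

-- Unions of pieces

get-++-< : ∀ {os₁ os₂} V {S} i c → length os₁ ≡ length V → i < length V →
           get (os₁ ++ os₂) (V ++ S) i c ≡ get os₁ V i c
get-++-< {o ∷ os₁} (r ∷ V) zero    c len _        = refl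
get-++-< {o ∷ os₁} (r ∷ V) (suc i) c len (s≤s i<) = get-++-< {os₁} V i c (suc-injective len) i<

module _ (os₁ os₂ : List ℕ) (V S : Filling) (len : length os₁ ≡ length V) where

  -- No vertical pair straddles the boundary: `get-upper` would place the lower neighbour of a cell
  -- of `V` in `V` as well.
  columns-++⁺ : ∀ {o} → All (o ≤_) os₁ → NothingBelow o os₂ S → ColumnsIncrease os₁ V → ColumnsIncrease os₂ S →
                ColumnsIncrease (os₁ ++ os₂) (V ++ S)
  columns-++⁺ {o} os≥ nb colsV colsS i c x y e₁ e₂ with i <? length V
  ... | yes i< = colsV i c x y e₁′
    (trans (sym (get-upper {o} {os₁} {os₂} V {S} (suc i) c len nb (get-offset-≤ os₁ V i c os≥ e₁′) i<)) e₂)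
    where
    e₁′ : get os₁ V i c ≡ just x
    e₁′ = trans (sym (get-++-< {os₁} {os₂} V {S} i c len i<)) e₁
  ... | no i≮ with j , refl ← m≤n⇒∃[o]m+o≡n (≮⇒≥ i≮) =
    colsS j c x y (trans (sym (get-lower {os₁} {os₂} V {S} j c len)) e₁)
      (trans (sym (get-lower {os₁} {os₂} V {S} (suc j) c len))
             (trans (cong (λ l → get (os₁ ++ os₂) (V ++ S) l c) (+-suc (length V) j)) e₂))

  columns-++⁻ˡ : ColumnsIncrease (os₁ ++ os₂) (V ++ S) → ColumnsIncrease os₁ V
  columns-++⁻ˡ cols i c x y e₁ e₂ = cols i c x y
    (trans (get-++-< {os₁} {os₂} V {S} i c len (get-just-< os₁ V i c e₁)) e₁)
    (trans (get-++-< {os₁} {os₂} V {S} (suc i) c len (get-just-< os₁ V (suc i) c e₂)) e₂)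

  columns-++⁻ʳ : ColumnsIncrease (os₁ ++ os₂) (V ++ S) → ColumnsIncrease os₂ S
  columns-++⁻ʳ cols i c x y e₁ e₂ = cols (length V + i) c x y
    (trans (get-lower {os₁} {os₂} V {S} i c len) e₁)
    (trans (cong (λ l → get (os₁ ++ os₂) (V ++ S) l c) (sym (+-suc (length V) i)))
           (trans (get-lower {os₁} {os₂} V {S} (suc i) c len) e₂))

columns-shift⁻ : ∀ s os F → ColumnsIncrease (map (s +_) os) F → ColumnsIncrease os F
columns-shift⁻ s os F cols i c x y e₁ e₂ =
  cols i (s + c) x y (trans (get-shift s os F i c) e₁) (trans (get-shift s os F (suc i) c) e₂)

-- A cell of the shifted shape has column at least `s`, so its column can be written as `s + c′`.
columns-shift⁺ : ∀ s os F → ColumnsIncrease os F → ColumnsIncrease (map (s +_) os) F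
columns-shift⁺ s os F cols i c x y e₁ e₂
  with c′ , refl ← m≤n⇒∃[o]m+o≡n (get-offset-≤ (map (s +_) os) F i c (All.map⁺ (All.universal (m≤m+n s) os)) e₁) =
  cols i c′ x y (trans (sym (get-shift s os F i c′)) e₁) (trans (sym (get-shift s os F (suc i) c′)) e₂)

UnionIncreasing : ℕ → List Partition → List Filling → Set
UnionIncreasing s ls Fs = All (Linked _<_) (unionFilling Fs)
                        × ColumnsIncrease (placedOffsets s ls) (unionFilling Fs)

union-increasing⁺ : ∀ s {ls Fs} → Pointwise HasShape ls Fs → All Increasing Fs → UnionIncreasing s ls Fs
union-increasing⁺ s [] [] = [] , λ _ _ _ _ ()
union-increasing⁺ s {λ′ ∷ ls} {F ∷ Fs} (sh ∷ shs) ((rows , cols) ∷ incs)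
  rewrite placedOffsets-∷ s λ′ ls F sh | concat-reverse-∷ F Fs
  with union-increasing⁺ (s + firstPart λ′) shs incs
... | rows′ , cols′ = All.++⁺ rows′ rows ,
  columns-++⁺ (placedOffsets (s + firstPart λ′) ls) (map (s +_) (zeros F)) (unionFilling Fs) F
    (placedOffsets-length (s + firstPart λ′) ls Fs shs) (placedOffsets-≥ (s + firstPart λ′) ls)
    (block-nothingBelow s λ′ F sh) cols′ (columns-shift⁺ s (zeros F) F cols)

union-increasing⁻ : ∀ s {ls Fs} → Pointwise HasShape ls Fs → UnionIncreasing s ls Fs → All Increasing Fs
union-increasing⁻ s [] _ = []
union-increasing⁻ s {λ′ ∷ ls} {F ∷ Fs} (sh ∷ shs) (rows , cols)
  rewrite placedOffsets-∷ s λ′ ls F sh | concat-reverse-∷ F Fs =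
  (All.++⁻ʳ (unionFilling Fs) rows , columns-shift⁻ s (zeros F) F (columns-++⁻ʳ os (map (s +_) (zeros F)) (unionFilling Fs) F len cols)) ∷
  union-increasing⁻ (s + firstPart λ′) shs (All.++⁻ˡ (unionFilling Fs) rows , columns-++⁻ˡ os (map (s +_) (zeros F)) (unionFilling Fs) F len cols)
  where
  os = placedOffsets (s + firstPart λ′) ls
  len : length (placedOffsets (s + firstPart λ′) ls) ≡ length (unionFilling Fs)
  len = placedOffsets-length (s + firstPart λ′) ls Fs shs

placedLengths : ℕ → List Partition → List ℕ
placedLengths s ls = map proj₂ (concat (reverse (placed s ls)))

placedLengths-∷ : ∀ s λ′ ls → placedLengths s (λ′ ∷ ls) ≡ placedLengths (s + firstPart λ′) ls ++ λ′
placedLengths-∷ s λ′ ls = begin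
  map proj₂ (concat (reverse (placed s (λ′ ∷ ls))))
    ≡⟨ cong (map proj₂) (concat-reverse-∷ (map (λ r → s , r) λ′) (placed (s + firstPart λ′) ls)) ⟩
  map proj₂ (concat (reverse (placed (s + firstPart λ′) ls)) ++ map (λ r → s , r) λ′)
    ≡⟨ map-++ proj₂ (concat (reverse (placed (s + firstPart λ′) ls))) _ ⟩
  placedLengths (s + firstPart λ′) ls ++ map proj₂ (map (λ r → s , r) λ′)
    ≡⟨ cong (placedLengths (s + firstPart λ′) ls ++_) (trans (sym (map-∘ λ′)) (map-id λ′)) ⟩
  placedLengths (s + firstPart λ′) ls ++ λ′ ∎
  where open ≡-Reasoning

placedLengths-sum : ∀ s ls → sum (placedLengths s ls) ≡ sum (map ∣_∣ₚ ls)
placedLengths-sum s []        = refl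
placedLengths-sum s (λ′ ∷ ls) = begin
  sum (placedLengths s (λ′ ∷ ls))                   ≡⟨ cong sum (placedLengths-∷ s λ′ ls) ⟩
  sum (placedLengths (s + firstPart λ′) ls ++ λ′)   ≡⟨ sum-++ (placedLengths (s + firstPart λ′) ls) λ′ ⟩
  sum (placedLengths (s + firstPart λ′) ls) + sum λ′ ≡⟨ cong (_+ sum λ′) (placedLengths-sum (s + firstPart λ′) ls) ⟩
  sum (map ∣_∣ₚ ls) + sum λ′                        ≡⟨ +-comm _ (sum λ′) ⟩
  sum λ′ + sum (map ∣_∣ₚ ls)                        ∎
  where open ≡-Reasoning

union-lengths : ∀ s {ls Fs} → Pointwise HasShape ls Fs → map length (unionFilling Fs) ≡ placedLengths s ls
union-lengths s [] = refl
union-lengths s {λ′ ∷ ls} {F ∷ Fs} (sh ∷ shs)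
  rewrite placedLengths-∷ s λ′ ls | concat-reverse-∷ F Fs | map-++ length (unionFilling Fs) F =
  cong₂ _++_ (union-lengths (s + firstPart λ′) shs) sh

map-length-++⁻ : ∀ (F : Filling) xs {ys} → map length F ≡ xs ++ ys →
                 ∃[ V ] ∃[ S ] (F ≡ V ++ S × map length V ≡ xs × map length S ≡ ys)
map-length-++⁻ F       []       eq = [] , F , refl , refl , eq
map-length-++⁻ (r ∷ F) (x ∷ xs) eq with map-length-++⁻ F xs (∷-injectiveʳ eq)
... | V , S , refl , e₁ , e₂ = r ∷ V , S , refl , cong₂ _∷_ (∷-injectiveˡ eq) e₁ , e₂

union-split : ∀ s ls F → map length F ≡ placedLengths s ls → ∃[ Fs ] (F ≡ unionFilling Fs × Pointwise HasShape ls Fs)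
union-split s []        []  eq = [] , refl , []
union-split s (λ′ ∷ ls) F eq
  with map-length-++⁻ F (placedLengths (s + firstPart λ′) ls) (trans eq (placedLengths-∷ s λ′ ls))
... | V , S , refl , e₁ , e₂ with union-split (s + firstPart λ′) ls V e₁
...   | Fs , refl , shs = S ∷ Fs , sym (concat-reverse-∷ S Fs) , e₂ ∷ shs

++-injective : ∀ (xs ys : Filling) {as bs} → length xs ≡ length ys → xs ++ as ≡ ys ++ bs → xs ≡ ys × as ≡ bs
++-injective []       []       len eq = refl , eq
++-injective (x ∷ xs) (y ∷ ys) len eq with ++-injective xs ys (suc-injective len) (∷-injectiveʳ eq)
... | e₁ , e₂ = cong₂ _∷_ (∷-injectiveˡ eq) e₁ , e₂

-- Equal shapes are cut at the same rows. This carries fixedness from the union down to each piece,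
-- as `step` preserves row lengths.
union-injective : ∀ {ls Fs Gs} → Pointwise HasShape ls Fs → Pointwise HasShape ls Gs →
                  unionFilling Fs ≡ unionFilling Gs → Fs ≡ Gs
union-injective [] [] eq = refl
union-injective {λ′ ∷ ls} {F ∷ Fs} {G ∷ Gs} (_ ∷ shs) (_ ∷ shs′) eq
  rewrite concat-reverse-∷ F Fs | concat-reverse-∷ G Gs
  with ++-injective (unionFilling Fs) (unionFilling Gs)
         (trans (sym (placedOffsets-length 0 ls Fs shs)) (placedOffsets-length 0 ls Gs shs′)) eq
... | e₁ , e₂ = cong₂ _∷_ e₂ (union-injective shs shs′ e₁)

union-↭ : ∀ Fs → concat (unionFilling Fs) ↭ concat (map concat Fs)
union-↭ []       = refl
union-↭ (F ∷ Fs) = begin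
  concat (unionFilling (F ∷ Fs))         ≡⟨ cong concat (concat-reverse-∷ F Fs) ⟩
  concat (unionFilling Fs ++ F)          ≡⟨ concat-++ (unionFilling Fs) F ⟨
  concat (unionFilling Fs) ++ concat F   ↭⟨ ++-comm (concat (unionFilling Fs)) (concat F) ⟩
  concat F ++ concat (unionFilling Fs)   ↭⟨ ++⁺ˡ (concat F) (union-↭ Fs) ⟩
  concat F ++ concat (map concat Fs)     ∎
  where open PermutationReasoning

unique-concat⁻ : ∀ xss → Unique (concat xss) → All Unique xss
unique-concat⁻ []         u = []
unique-concat⁻ (xs ∷ xss) u = unique-++⁻ˡ xs u ∷ unique-concat⁻ xss (unique-++⁻ʳ xs u)

∣gcdList : ∀ {k} ns → All (k ∣_) ns → k ∣ gcdList ns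
∣gcdList {k} []       []         = k ∣0
∣gcdList     (n ∷ ns) (k∣n ∷ ds) = gcd-greatest k∣n (∣gcdList ns ds)

gcdList∣ : ∀ {k} ns → k ∣ gcdList ns → All (k ∣_) ns
gcdList∣ []       k∣ = []
gcdList∣ (n ∷ ns) k∣ = ∣-trans k∣ (gcd[m,n]∣m n (gcdList ns)) ∷ gcdList∣ ns (∣-trans k∣ (gcd[m,n]∣n n (gcdList ns)))

range-upTo : ∀ n → All (InRange n) (map suc (upTo n))
range-upTo n = All.map⁺ (All.applyUpTo⁺₁ id n (λ x<n → z<s , x<n))

-- Fixed points of promotion on the union

module Theorem {ls : List Partition} (parts : All IsPartition ls) {n k m : ℕ} .{{_ : NonZero k}}
               (n≡sum : n ≡ sum (map ∣_∣ₚ ls)) (n≡km : n ≡ k * m) where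

  -- For `n = 0` there is no entry 1 to evict, but `k` is nonzero, so `m = 0` and nothing is
  -- iterated.
  iter-union : ∀ {Fs} → Pointwise HasShape ls Fs → Standard n (unionFilling Fs) →
               iter m (pr (unionShape ls)) (unionFilling Fs) ≡ unionFilling (map (iter m (step n)) Fs)
  iter-union {Fs} shs st with 0 <? n
  ... | yes n>0 = proj₁ (iter-pr-union m ls Fs n>0 shs st)
  ... | no  n≯0 with m*n≡0⇒m≡0∨n≡0 k (trans (sym n≡km) (n≤0⇒n≡0 (≮⇒≥ n≯0)))
  ...   | inj₁ k≡0 = contradiction k≡0 (≢-nonZero⁻¹ k)
  ...   | inj₂ refl = cong unionFilling (sym (map-id Fs))

  Tuple : Filling → Set
  Tuple F = ∃[ Ts ] ∃[ Ms ]
    ( Pointwise (λ λj Tj → FixedSYT (straight λj) (∣ λj ∣ₚ / k) Tj) ls Ts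
    × All (Linked _<_) Ms
    × (concat Ms ↭ map suc (upTo m))
    × Pointwise (λ λj Mj → length Mj ≡ ∣ λj ∣ₚ / k) ls Ms
    × F ≡ unionFilling (zipWith (I m) Ms Ts))

  decompose-all : ∀ {ls Fs} → All IsPartition ls → Pointwise HasShape ls Fs → All Increasing Fs →
    All Unique (map concat Fs) → All (All (InRange n)) (map concat Fs) → map (iter m (step n)) Fs ≡ Fs →
    Pointwise (Decomposed k m) ls Fs
  decompose-all []       []         []           []       []       fix = []
  decompose-all (p ∷ ps) (sh ∷ shs) (inc ∷ incs) (u ∷ us) (r ∷ rs) fix =
    decompose _ n≡km p sh inc u r (∷-injectiveˡ fix) ∷ decompose-all ps shs incs us rs (∷-injectiveʳ fix)

  -- The partition of `[m]` is invisible piece by piece, so only the small entries of all pieces are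
  -- collected here.
  gather : ∀ {ls Fs} → Pointwise (Decomposed k m) ls Fs → ∃[ Ts ] ∃[ Ms ]
    ( Pointwise (λ λj Tj → FixedSYT (straight λj) (∣ λj ∣ₚ / k) Tj) ls Ts
    × All (Linked _<_) Ms
    × filter (_≤? m) (concat (map concat Fs)) ↭ concat Ms
    × Pointwise (λ λj Mj → length Mj ≡ ∣ λj ∣ₚ / k) ls Ms
    × Fs ≡ zipWith (I m) Ms Ts)
  gather [] = [] , [] , [] , [] , refl , [] , refl
  gather {Fs = F ∷ Fs} (d ∷ ds) with gather ds
  ... | Ts , Ms , fixed , ms↗ , smalls , lens , eq =
    tableau ∷ Ts , labels ∷ Ms , D.fixed ∷ fixed , increasing ∷ ms↗ ,
    ↭-trans (↭-reflexive (filter-++ (_≤? m) (concat F) (concat (map concat Fs)))) (++⁺ small smalls) ,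
    length≡ ∷ lens , cong₂ _∷_ F≡ eq
    where
    open module D = Decomposed d hiding (fixed)

  -- Divisibility of the gcd is a conclusion, not a hypothesis, so its contrapositive gives the
  -- empty case of the theorem.
  forward : ∀ F → FixedSYT (unionShape ls) m F → Tuple F × k ∣ gcdList (map ∣_∣ₚ ls)
  forward F ((lengths , content , rows , columns) , fix) with union-split 0 ls F lengths
  ... | Fs , refl , shs = tuple , ∣gcdList _ (All.map⁺ (divisors decomposed))
    where
    st : Standard n (unionFilling Fs)
    st = subst (λ N → Standard N (unionFilling Fs)) (trans (placedLengths-sum 0 ls) (sym n≡sum)) content
    pieces↭ : concat (map concat Fs) ↭ map suc (upTo n)
    pieces↭ = ↭-trans (↭-sym (union-↭ Fs)) st
    decomposed : Pointwise (Decomposed k m) ls Fs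
    decomposed = decompose-all parts shs (union-increasing⁻ 0 shs (rows , columns))
      (unique-concat⁻ (map concat Fs) (unique-resp-↭ (union-↭ Fs) (standard-unique (unionFilling Fs) st)))
      (All.concat⁻ (All-resp-↭ (↭-sym pieces↭) (range-upTo n)))
      (union-injective (iter-shape n m shs) shs (trans (sym (iter-union shs st)) fix))
    divisors : ∀ {ls Fs} → Pointwise (Decomposed k m) ls Fs → All (λ λ′ → k ∣ ∣ λ′ ∣ₚ) ls
    divisors []       = []
    divisors (d ∷ ds) = Decomposed.divisible d ∷ divisors ds
    m≤n : m ≤ n
    m≤n = subst (m ≤_) (sym n≡km) (m≤n*m m k)
    small↭ : filter (_≤? m) (map suc (upTo n)) ≡ map suc (upTo m)
    small↭ = trans (cong (filter (_≤? m)) (trans (map-upTo suc n) (cong (applyUpTo suc) (sym (m+[n∸m]≡n m≤n)))))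
      (trans (filter-≤-applyUpTo m (n ∸ m) id (λ x → s≤s (m≤m+n m x))) (sym (map-upTo suc m)))
    tuple : Tuple (unionFilling Fs)
    tuple with gather decomposed
    ... | Ts , Ms , fixed , ms↗ , smalls , lens , eq = Ts , Ms , fixed , ms↗ ,
      -- The label sets together are the entries at most `m` of a standard filling, that is 1, ...,
      -- m.
      ↭-trans (↭-sym smalls) (↭-trans (filter-↭ (_≤? m) pieces↭) (↭-reflexive small↭)) ,
      lens , cong unionFilling eq

  compose-all : ∀ {ls Ts Ms} → All IsPartition ls → All (λ λ′ → k ∣ ∣ λ′ ∣ₚ) ls →
    Pointwise (λ λj Tj → FixedSYT (straight λj) (∣ λj ∣ₚ / k) Tj) ls Ts →
    All (Linked _<_) Ms → All (All (InRange m)) Ms → Pointwise (λ λj Mj → length Mj ≡ ∣ λj ∣ₚ / k) ls Ms →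
    let Fs = zipWith (I m) Ms Ts in
    Pointwise HasShape ls Fs × All Increasing Fs × map (iter m (step n)) Fs ≡ Fs
    × concat (map concat Fs) ↭ translates k m (concat Ms)
  compose-all [] [] [] [] [] [] = [] , [] , refl , ↭-reflexive (sym (translates-[] k m))
  compose-all (p ∷ ps) (d ∷ ds) (f ∷ fs) (l ∷ ls) (r ∷ rs) (e ∷ es)
    with compose _ _ n≡km p d f l r e | compose-all ps ds fs ls rs es
  ... | sh , inc , fix , content | shs , incs , fixes , contents =
    sh ∷ shs , inc ∷ incs , cong₂ _∷_ fix fixes ,
    ↭-trans (++⁺ content contents) (↭-sym (translates-++ k m _ _))

  backward : k ∣ gcdList (map ∣_∣ₚ ls) → ∀ F → Tuple F → FixedSYT (unionShape ls) m F
  backward k∣ F (Ts , Ms , fixed , ms↗ , partition , lens , refl)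
    with compose-all parts (All.map⁻ (gcdList∣ _ k∣)) fixed ms↗
           (All.concat⁻ (All-resp-↭ (↭-sym partition) (range-upTo m))) lens
  ... | shs , incs , fixes , contents =
    (union-lengths 0 shs , subst (λ N → Standard N F) (trans n≡sum (sym (placedLengths-sum 0 ls))) st ,
     union-increasing⁺ 0 shs incs) ,
    trans (iter-union shs st) (cong unionFilling fixes)
    where
    Fs = zipWith (I m) Ms Ts
    st : Standard n F
    -- The pieces contribute the translates of their label sets; together these are the `k`
    -- translates of `[m]` by multiples of `m`, which tile `[n]`.
    st = begin
      concat F                               ↭⟨ union-↭ Fs ⟩
      concat (map concat Fs)                 ↭⟨ contents ⟩
      translates k m (concat Ms)             ↭⟨ translates-↭ k m partition ⟩
      translates k m (map suc (upTo m))      ≡⟨ cong (translates k m) (map-upTo suc m) ⟩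
      translates k m (applyUpTo suc m)       ≡⟨ applyUpTo-translates {suc} (λ _ → refl) k ⟨
      applyUpTo suc (k * m)                  ≡⟨ cong (applyUpTo suc) n≡km ⟨
      applyUpTo suc n                        ≡⟨ map-upTo suc n ⟨
      map suc (upTo n)                       ∎
      where open PermutationReasoning

theorem7p7 : (ls : List Partition) → All IsPartition ls →
    (n : ℕ) → n ≡ sum (map ∣_∣ₚ ls) →
    (k : ℕ) → .{{_ : NonZero k}} → k ∣ n →
    ((k ∣ gcdList (map ∣_∣ₚ ls)) →
    ∀ (F : Filling) →
    (FixedSYT (unionShape ls) (n / k) F →
    ∃[ Ts ] ∃[ Ms ]
    ( Pointwise (λ λj Tj → FixedSYT (straight λj) (∣ λj ∣ₚ / k) Tj) ls Ts
    × All (Linked _<_) Ms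
    × (concat Ms ↭ map suc (upTo (n / k)))
    × Pointwise (λ λj Mj → length Mj ≡ ∣ λj ∣ₚ / k) ls Ms
    × F ≡ unionFilling (zipWith (I (n / k)) Ms Ts)))
    × ((∃[ Ts ] ∃[ Ms ]
    ( Pointwise (λ λj Tj → FixedSYT (straight λj) (∣ λj ∣ₚ / k) Tj) ls Ts
    × All (Linked _<_) Ms
    × (concat Ms ↭ map suc (upTo (n / k)))
    × Pointwise (λ λj Mj → length Mj ≡ ∣ λj ∣ₚ / k) ls Ms
    × F ≡ unionFilling (zipWith (I (n / k)) Ms Ts))) →
    FixedSYT (unionShape ls) (n / k) F))
    × (¬ (k ∣ gcdList (map ∣_∣ₚ ls)) →
    ∀ (F : Filling) → ¬ FixedSYT (unionShape ls) (n / k) F)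
theorem7p7 ls parts n n≡sum k k∣n =
  (λ k∣gcd F → (λ fixed → proj₁ (forward F fixed)) , backward k∣gcd F) ,
  λ k∤gcd F fixed → k∤gcd (proj₂ (forward F fixed))
  where open Theorem parts n≡sum (sym (m*[n/m]≡n k∣n))
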